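{- If $\mathfrak{s}_{\omega,\omega} \leq \mathfrak{b}$, then there is a weakly tight family $\mathscr{A} \subset [\omega]^{\omega}$ of size $\mathfrak{c}$. In particular, weakly tight families of size $\mathfrak{c}$ exist if $\mathfrak{b} = \mathfrak{d}$, or if $\mathfrak{s}_{\omega,\omega} = \omega_1$.
   Context: We work in ZFC. $[\omega]^{\omega}$ is the set of infinite subsets of $\omega$, $\mathfrak{c}=2^{\aleph_0}$, $\bar e = \omega\setminus e$ for $e \subset \omega$, and $\exists^{\infty} n$ means "for infinitely many $n\in\omega$". $\mathfrak{b}$ and $\mathfrak{d}$ are the usual bounding and dominating numbers: the least size of an unbounded, respectively dominating, family in $\omega^{\omega}$ under eventual domination. $\mathfrak{s}_{\omega,\omega}$ is the least cardinal $\kappa$ such that there is a family $\{e_\alpha : \alpha<\kappa\}\subset[\omega]^{\omega}$ such that for any collection $\{b_n : n\in\omega\}\subset[\omega]^{\omega}$ there exists $\alpha<\kappa$ with $\exists^{\infty} n\in\omega\,(|b_n\cap e_\alpha|=\omega)$ and $\exists^{\infty} n\in\omega\,(|b_n\cap \bar e_\alpha|=\omega)$. A family $\mathscr{A}\subset[\omega]^{\omega}$ is almost disjoint (a.d.) if any two distinct members have finite intersection. $\mathcal{I}(\mathscr{A})$ is the ideal on $\omega$ generated by $\mathscr{A}$ (ideals on $\omega$ contain all finite sets, so $x\in\mathcal{I}(\mathscr{A})$ iff $x\setminus\bigcup\mathcal{F}$ is finite for some finite $\mathcal{F}\subset\mathscr{A}$), and $\mathcal{I}^{+}(\mathscr{A})=\mathcal{P}(\omega)\setminus\mathcal{I}(\mathscr{A})$.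 An a.d. family $\mathscr{A}\subset[\omega]^{\omega}$ is weakly tight if for every countable collection $\{b_n : n\in\omega\}\subset\mathcal{I}^{+}(\mathscr{A})$ there is $a\in\mathscr{A}$ such that $\exists^{\infty} n\in\omega\,(|b_n\cap a|=\omega)$. -}

module Defs where

open import Data.Bool.Base using (Bool; T; not; _∧_)
open import Data.List.Base using (List)
open import Data.List.Relation.Unary.All using (All)
open import Data.List.Relation.Unary.Any using (Any)
open import Data.Nat.Base using (ℕ; _≤_)
open import Data.Nat.InfinitelyOften using (Fin; Inf)
open import Data.Product.Base using (Σ-syntax; ∃-syntax; _×_)
open import Function.Bundles using (_↣_; _⤖_)
open import Relation.Binary.PropositionalEquality using (_≢_)
open import Relation.Nullary.Negation.Core using (¬_)

-- Everything below is meant to be read under excluded middle for all types and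
-- function extensionality, which the theorem assumes as its counterpart of ZFC.
-- Excluded middle for all types (not just propositions) gives ¬ ¬ A → A
-- uniformly in A, hence the axiom of choice.

-- Power sets as Bool-valued functions: under excluded middle every subset is of
-- this form, under extensionality equal subsets are _≡_, and T (A x) has at
-- most one proof, so that El A has exactly one element per member of A.
𝒫 : Set → Set
𝒫 X = X → Bool

infix 4 _∈_
_∈_ : {X : Set} → X → 𝒫 X → Set
x ∈ A = T (A x)

El : {X : Set} → 𝒫 X → Set
El {X} A = Σ[ x ∈ X ] x ∈ A

infixr 7 _∩_
_∩_ : {X : Set} → 𝒫 X → 𝒫 X → 𝒫 X
(A ∩ B) x = A x ∧ B x

∁ : {X : Set} → 𝒫 X → 𝒫 X
∁ A x = not (A x)

-- Inf P is the quantifier "P n for infinitely many n".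
Finite Infinite : 𝒫 ℕ → Set
Finite   x = Fin (_∈ x)
Infinite x = Inf (_∈ x)

-- Cardinals are represented by types, compared by injections and identified
-- along bijections. Least Φ K says that K represents the least cardinal
-- satisfying Φ.
Least : (Set → Set) → Set → Set₁
Least Φ K = Φ K × (∀ (L : Set) → Φ L → K ↣ L)

infix 4 _≤*_
_≤*_ : (ℕ → ℕ) → (ℕ → ℕ) → Set
f ≤* g = ∃[ m ] (∀ n → m ≤ n → f n ≤ g n)

Unbounded : 𝒫 (ℕ → ℕ) → Set
Unbounded F = ¬ (∃[ g ] (∀ f → f ∈ F → f ≤* g))

Dominating : 𝒫 (ℕ → ℕ) → Set
Dominating F = ∀ f → ∃[ g ] (g ∈ F × f ≤* g)

Is-𝔟 : Set → Set₁
Is-𝔟 = Least (λ K → ∃[ F ] (Unbounded F × (El F ⤖ K)))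

Is-𝔡 : Set → Set₁
Is-𝔡 = Least (λ K → ∃[ F ] (Dominating F × (El F ⤖ K)))

Is-ω₁ : Set → Set₁
Is-ω₁ = Least (λ K → ¬ (K ↣ ℕ))

ωω-Splitting : {K : Set} → (K → 𝒫 ℕ) → Set
ωω-Splitting {K} e =
  (b : ℕ → 𝒫 ℕ) → (∀ n → Infinite (b n)) →
  ∃[ α ] (Inf (λ n → Infinite (b n ∩ e α)) × Inf (λ n → Infinite (b n ∩ ∁ (e α))))

Is-𝔰ωω : Set → Set₁
Is-𝔰ωω = Least (λ K → Σ[ e ∈ (K → 𝒫 ℕ) ] ((∀ α → Infinite (e α)) × ωω-Splitting e))

AlmostDisjoint : 𝒫 (𝒫 ℕ) → Set
AlmostDisjoint 𝒜 = ∀ a a′ → a ∈ 𝒜 → a′ ∈ 𝒜 → a ≢ a′ → Finite (a ∩ a′)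

InIdeal : 𝒫 (𝒫 ℕ) → 𝒫 ℕ → Set
InIdeal 𝒜 x =
  Σ[ F ∈ List (𝒫 ℕ) ] (All (_∈ 𝒜) F × Fin (λ n → n ∈ x × ¬ Any (n ∈_) F))

Positive : 𝒫 (𝒫 ℕ) → 𝒫 ℕ → Set
Positive 𝒜 x = ¬ InIdeal 𝒜 x

record WeaklyTight (𝒜 : 𝒫 (𝒫 ℕ)) : Set where
  field
    infinite       : ∀ a → a ∈ 𝒜 → Infinite a
    almostDisjoint : AlmostDisjoint 𝒜
    tight          : (b : ℕ → 𝒫 ℕ) → (∀ n → Positive 𝒜 (b n)) →
                     ∃[ a ] (a ∈ 𝒜 × Inf (λ n → Infinite (b n ∩ a)))

-- 𝔠 = 2^ℵ₀ is represented by 𝒫 ℕ.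
WeaklyTightOfSize𝔠 : Set
WeaklyTightOfSize𝔠 = ∃[ 𝒜 ] (WeaklyTight 𝒜 × (El 𝒜 ⤖ 𝒫 ℕ))

-- Fix an (ω,ω)-splitting family e of size at most 𝔟, indexed by a well-order all
-- of whose proper initial segments have fewer than 𝔟 elements. Members are built
-- by a recursion of length 𝔠, stage δ dealing with the δ-th sequence b of
-- positive sets. Cutting a positive set again and again along the first e α both
-- of whose sides stay positive gives a binary tree; its 2^ω paths carry pairwise
-- clashing partial functions ("nodes") on the index set, and fewer than 𝔠 earlier
-- stages leave a path whose node is extended by no earlier node. Earlier sets with
-- a clashing node are then almost disjoint for free. The other ones have nodes
-- that are proper restrictions, at most one stage for each restriction, and so
-- few sets are avoided by domination.
-- Done for each b n separately, this yields x n ⊆ b n almost disjoint from all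
-- earlier sets. The x n follow different nodes, so the tree argument is run again
-- on the sequence x, where a sequence is good if infinitely many terms are
-- infinite. The new set is a union of pieces of the x n, which follows the node of
-- the path only modulo finitely many pieces at each coordinate; recording the
-- nodes of the pieces as well makes up for this.

module Submission where

open import Defs
open import Axiom.ExcludedMiddle using (ExcludedMiddle)
open import Axiom.Extensionality.Propositional using (Extensionality)
open import Data.Bool.Base using (Bool; true; false; T; not)
open import Data.Bool.Properties using (T-irrelevant; T-∧; ¬-not)
open import Data.Empty using (⊥; ⊥-elim)
open import Data.List.Base using (List; []; _∷_; _++_)
open import Data.List.Relation.Unary.All as All using (All; []; _∷_)
import Data.List.Relation.Unary.All.Properties as All
open import Data.List.Relation.Unary.Any as Any using (Any; here; there)
import Data.List.Relation.Unary.Any.Properties as Any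
open import Data.Nat.Base
open import Data.Nat.InfinitelyOften using (Fin; Inf; _∪-Fin_)
open import Data.Nat.Properties
open import Data.Product.Base using (Σ-syntax; ∃; ∃-syntax; _×_; _,_; proj₁; proj₂; map₂)
open import Data.Sum.Base using (_⊎_; inj₁; inj₂; [_,_]′)
open import Data.Unit.Base using (⊤; tt)
open import Function.Base using (_∘_; id; const)
open import Function.Bundles using (_↣_; _⤖_; mk↣; mk⤖; Equivalence; Injection; Bijection)
open import Function.Construct.Composition using (_↣-∘_)
open import Function.Construct.Identity using (⤖-id)
open import Function.Properties.Bijection using (sym-≡)
open import Induction.WellFounded using (Acc; acc; WellFounded)
import Induction.WellFounded as WF
open import Level using (Level)
open import Relation.Binary.PropositionalEquality
  using (_≡_; _≢_; refl; sym; trans; cong; cong₂; subst)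
open import Relation.Binary.Definitions using (tri<; tri≈; tri>)
open import Relation.Nullary.Decidable.Core using (yes; no; ⌊_⌋; toWitness; fromWitness)
open import Relation.Nullary.Negation.Core using (¬_; contradiction)

private variable
  ℓ ℓ′ : Level

-- Finite sets, almost disjointness, eventual domination.

infix 4 _⟂_ _⊆_

_⟂_ : 𝒫 ℕ → 𝒫 ℕ → Set
x ⟂ y = Fin (λ n → n ∈ x × n ∈ y)

_⊆_ : {X : Set} → 𝒫 X → 𝒫 X → Set
x ⊆ y = ∀ n → n ∈ x → n ∈ y

Eventually : (ℕ → Set ℓ) → Set ℓ
Eventually P = ∃[ m ] ∀ k → m ≤ k → P k

Fin-⊆ : {P : ℕ → Set ℓ} {Q : ℕ → Set ℓ′} → (∀ n → Q n → P n) → Fin P → Fin Q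
Fin-⊆ Q⊆P (i , none) = i , λ j i≤j q → none j i≤j (Q⊆P j q)

Inf-⊆ : {P : ℕ → Set ℓ} {Q : ℕ → Set ℓ′} → (∀ n → P n → Q n) → Inf P → Inf Q
Inf-⊆ P⊆Q inf fin = inf (Fin-⊆ P⊆Q fin)

Fin-⋃< : {P : ℕ → ℕ → Set} → ∀ m → (∀ k → k < m → Fin (P k)) → Fin (λ n → ∃[ k ] (k < m × P k n))
Fin-⋃< zero fin = 0 , λ { _ _ (_ , () , _) }
Fin-⋃< {P} (suc m) fin =
  Fin-⊆ split (fin m ≤-refl ∪-Fin Fin-⋃< m (λ k k<m → fin k (m<n⇒m<1+n k<m)))
  where
  split : ∀ n → ∃[ k ] (k < suc m × P k n) → P m n ⊎ ∃[ k ] (k < m × P k n)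
  split n (k , k<1+m , p) with m≤n⇒m<n∨m≡n (≤-pred k<1+m)
  ... | inj₁ k<m = inj₂ (k , k<m , p)
  ... | inj₂ refl = inj₁ p

Fin-below : ∀ m → Fin (_< m)
Fin-below m = m , λ j m≤j j<m → <⇒≱ j<m m≤j

Fin-single : ∀ c → Fin (_≡ c)
Fin-single c = suc c , λ { j c<c refl → <-irrefl refl c<c }

Fin-Any : (x : 𝒫 ℕ) (F : List (𝒫 ℕ)) → All (x ⟂_) F → Fin (λ n → n ∈ x × Any (n ∈_) F)
Fin-Any x [] [] = 0 , λ { _ _ (_ , ()) }
Fin-Any x (a ∷ F) (fin ∷ fins) = Fin-⊆ split (fin ∪-Fin Fin-Any x F fins)
  where
  split : ∀ n → n ∈ x × Any (n ∈_) (a ∷ F) → (n ∈ x × n ∈ a) ⊎ (n ∈ x × Any (n ∈_) F)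
  split n (n∈x , here n∈a) = inj₁ (n∈x , n∈a)
  split n (n∈x , there n∈F) = inj₂ (n∈x , n∈F)

⟂-sym : ∀ {x y} → x ⟂ y → y ⟂ x
⟂-sym = Fin-⊆ λ { _ (p , q) → q , p }

⟂-⊆ : ∀ {x y x′ y′} → x′ ⊆ x → y′ ⊆ y → x ⟂ y → x′ ⟂ y′
⟂-⊆ x′⊆x y′⊆y = Fin-⊆ λ { n (p , q) → x′⊆x n p , y′⊆y n q }

⟂⋃ : ∀ {x} (y : ℕ → 𝒫 ℕ) m → (∀ k → k < m → x ⟂ y k) → Fin (λ n → n ∈ x × ∃[ k ] (k < m × n ∈ y k))
⟂⋃ y m fin = Fin-⊆ (λ { n (p , k , k<m , q) → k , k<m , p , q }) (Fin-⋃< m fin)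

∩⁺ : {X : Set} (x y : 𝒫 X) {n : X} → n ∈ x → n ∈ y → n ∈ x ∩ y
∩⁺ x y p q = Equivalence.from T-∧ (p , q)

∩⁻ : {X : Set} (x y : 𝒫 X) {n : X} → n ∈ x ∩ y → n ∈ x × n ∈ y
∩⁻ x y = Equivalence.to T-∧

≤*-trans : ∀ {f g h} → f ≤* g → g ≤* h → f ≤* h
≤*-trans (m , p) (m′ , q) = m ⊔ m′ , λ n m≤n →
  ≤-trans (p n (≤-trans (m≤m⊔n m m′) m≤n)) (q n (≤-trans (m≤n⊔m m m′) m≤n))

-- Sets with fewer than 𝔟 elements are small. Unlike "fewer than 𝔟", smallness is
-- closed under countable unions without any appeal to the cofinality of 𝔟.
SmallSet : {X : Set ℓ} → (X → Set ℓ′) → Set (ℓ Level.⊔ ℓ′)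
SmallSet {X = X} C = (h : X → ℕ → ℕ) → ∃[ g ] (∀ x → C x → h x ≤* g)

Small-⊆ : {X : Set ℓ} {C C′ : X → Set ℓ′} → (∀ x → C x → C′ x) → SmallSet C′ → SmallSet C
Small-⊆ C⊆C′ small h with small h
... | g , bound = g , λ x x∈C → bound x (C⊆C′ x x∈C)

El-≡ : {X : Set} {B : 𝒫 X} {x y : El B} → proj₁ x ≡ proj₁ y → x ≡ y
El-≡ {B = B} {x , p} {_ , q} refl = cong (x ,_) (T-irrelevant {B x} p q)

-- Classical reasoning about infinitely many.

module Classical
  (em : ∀ {ℓ} → ExcludedMiddle ℓ)
  (ext : ∀ {a b} → Extensionality a b)
  where

  dne : {A : Set ℓ} → ¬ ¬ A → A
  dne {A = A} ¬¬a with em {P = A}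
  ... | yes a = a
  ... | no ¬a = contradiction ¬a ¬¬a

  ¬∀⇒∃¬ : {A : Set ℓ} {P : A → Set ℓ′} → ¬ (∀ x → P x) → ∃[ x ] ¬ P x
  ¬∀⇒∃¬ ¬∀ = dne λ ¬∃ → ¬∀ λ x → dne λ ¬p → ¬∃ (x , ¬p)

  ⟦_⟧ : {X : Set} → (X → Set ℓ) → 𝒫 X
  ⟦ P ⟧ x = ⌊ em {P = P x} ⌋

  ⟦⟧⁺ : {X : Set} (P : X → Set ℓ) {x : X} → P x → x ∈ ⟦ P ⟧
  ⟦⟧⁺ P = fromWitness

  ⟦⟧⁻ : {X : Set} (P : X → Set ℓ) {x : X} → x ∈ ⟦ P ⟧ → P x
  ⟦⟧⁻ P = toWitness

  ⊆-antisym : {X : Set} {x y : 𝒫 X} → x ⊆ y → y ⊆ x → x ≡ y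
  ⊆-antisym {x = x} {y} x⊆y y⊆x = ext λ n → bool-≡ (x⊆y n) (y⊆x n)
    where
    bool-≡ : ∀ {b c} → (T b → T c) → (T c → T b) → b ≡ c
    bool-≡ {false} {false} f g = refl
    bool-≡ {false} {true}  f g = ⊥-elim (g tt)
    bool-≡ {true}  {false} f g = ⊥-elim (f tt)
    bool-≡ {true}  {true}  f g = refl

  infinitely-often : {P : ℕ → Set ℓ} → Inf P → ∀ m → ∃[ n ] (m ≤ n × P n)
  infinitely-often inf m = dne λ none → inf (m , λ n m≤n p → none (n , m≤n , p))

  Inf-intro : {P : ℕ → Set ℓ} → (∀ m → ∃[ n ] (m ≤ n × P n)) → Inf P
  Inf-intro unbounded (m , none) with unbounded m
  ... | n , m≤n , p = none n m≤n p

  Inf-Eventually : {P : ℕ → Set ℓ} {Q : ℕ → Set ℓ′} → Inf P → Eventually Q → ∃[ n ] (P n × Q n)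
  Inf-Eventually inf (m , q) with infinitely-often inf m
  ... | n , m≤n , p = n , p , q n m≤n

  Inf-⊎ : {P Q : ℕ → Set} → Inf (λ n → P n ⊎ Q n) → Inf P ⊎ Inf Q
  Inf-⊎ {P = P} {Q} inf with em {P = Fin P} | em {P = Fin Q}
  ... | no infP | _ = inj₁ infP
  ... | yes _ | no infQ = inj₂ infQ
  ... | yes finP | yes finQ = contradiction (finP ∪-Fin finQ) inf

  -- The junk value at an infinite P is 0.
  bound : (ℕ → Set) → ℕ
  bound P with em {P = Fin P}
  ... | yes (m , _) = m
  ... | no _ = 0

  <bound : ∀ {P} → Fin P → ∀ {n} → P n → n < bound P
  <bound {P} fin {n} p with em {P = Fin P}
  ... | yes (m , none) = ≰⇒> λ m≤n → none n m≤n p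
  ... | no inf = contradiction fin inf

  -- Bounded families of functions and small sets.

  ≤*-bounded-sequence : (h : ℕ → ℕ → ℕ) → ∃[ g ] (∀ i → h i ≤* g)
  -- At n this is the maximum of the first n + 1 functions.
  ≤*-bounded-sequence h = (λ n → max n n) , λ i → i , λ n i≤n → ≤max n i n i≤n
    where
    max : ℕ → ℕ → ℕ
    max zero n = h 0 n
    max (suc k) n = h (suc k) n ⊔ max k n

    ≤max : ∀ k i n → i ≤ k → h i n ≤ max k n
    ≤max zero zero n z≤n = ≤-refl
    ≤max (suc k) i n i≤k with m≤n⇒m<n∨m≡n i≤k
    ... | inj₁ i<k = ≤-trans (≤max k i n (≤-pred i<k)) (m≤n⊔m _ _)
    ... | inj₂ refl = m≤m⊔n _ _

  Small-ℕ : (C : ℕ → Set) → SmallSet C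
  Small-ℕ C h with ≤*-bounded-sequence h
  ... | g , h≤g = g , λ i _ → h≤g i

  -- Bound h on each `D i` by one function, then bound these functions as i runs through C.
  Small-⋃ : {I X : Set} {C : I → Set} {D : I → X → Set} →
            SmallSet C → (∀ i → C i → SmallSet (D i)) → SmallSet (λ x → ∃[ i ] (C i × D i x))
  Small-⋃ {I} {X} {C} {D} C-small D-small h =
    proj₁ bounded , λ { x (i , i∈C , x∈D) → ≤*-trans (spec i i∈C x x∈D) (proj₂ bounded i i∈C) }
    where
    bounded-on : ∀ i → ∃[ g ] (C i → ∀ x → D i x → h x ≤* g)
    bounded-on i with em {P = C i}
    ... | yes i∈C = map₂ (λ p _ → p) (D-small i i∈C h)
    ... | no i∉C = const 0 , λ i∈C → contradiction i∈C i∉C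

    spec = λ i → proj₂ (bounded-on i)
    bounded = C-small (λ i → proj₁ (bounded-on i))

  Small-⋃ℕ : {X : Set} {D : ℕ → X → Set} →
             (∀ i → SmallSet (D i)) → SmallSet (λ x → ∃[ i ] D i x)
  Small-⋃ℕ small =
    Small-⊆ (λ { x (i , x∈D) → i , tt , x∈D }) (Small-⋃ (Small-ℕ (λ _ → ⊤)) (λ i _ → small i))

  Small-⊎ : {X : Set} {C D : X → Set} → SmallSet C → SmallSet D → SmallSet (λ x → C x ⊎ D x)
  Small-⊎ {C = C} {D} C-small D-small =
    Small-⊆ (λ { x (inj₁ p) → 0 , p ; x (inj₂ q) → 1 , q }) (Small-⋃ℕ {D = pick} λ { zero → C-small ; (suc _) → D-small })
    where
    pick : ℕ → _ → Set
    pick zero = C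
    pick (suc _) = D

  Small-subsingleton : {X : Set} {C : X → Set} → (∀ x y → C x → C y → x ≡ y) → SmallSet C
  Small-subsingleton {C = C} unique h with em {P = ∃ C}
  ... | yes (x , x∈C) = h x , λ y y∈C → 0 , λ n _ → ≤-reflexive (cong (λ z → h z n) (unique y x y∈C x∈C))
  ... | no empty = const 0 , λ y y∈C → contradiction (y , y∈C) empty

  Small-List : {X : Set} (F : List X) → SmallSet (λ x → Any (x ≡_) F)
  Small-List [] = Small-subsingleton λ { _ _ () }
  Small-List (x ∷ F) =
    Small-⊆ (λ { y (here y≡x) → inj₁ y≡x ; y (there y∈F) → inj₂ y∈F })
      (Small-⊎ (Small-subsingleton λ { _ _ refl refl → refl }) (Small-List F))

  -- Each w gives the function bounding y k ∩ w, and smallness provides one g dominating all of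
  -- these. The finitely many k with y k ∩ w infinite are absorbed by the eventual quantifier.
  dodge : {W : 𝒫 ℕ → Set} → SmallSet W → (y : ℕ → 𝒫 ℕ) →
          (∀ w → W w → Eventually (λ k → y k ⟂ w)) →
          ∃[ g ] (∀ w → W w → Eventually (λ k → ∀ n → g k ≤ n → n ∈ y k → ¬ n ∈ w))
  dodge small y fin with small (λ w k → bound (λ n → n ∈ y k × n ∈ w))
  ... | g , dominates = g , λ w w∈W →
    let (m , p) = dominates w w∈W ; (m′ , q) = fin w w∈W in
    m ⊔ m′ , λ k m≤k n g≤n n∈y n∈w →
      <⇒≱ (<bound (q k (≤-trans (m≤n⊔m m m′) m≤k)) (n∈y , n∈w))
          (≤-trans (p k (≤-trans (m≤m⊔n m m′) m≤k)) g≤n)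

  -- Coding sequences of sets by single sets.

  unpair : ℕ → ℕ × ℕ
  unpair zero = 0 , 0
  unpair (suc n) with unpair n
  ... | a , zero = 0 , suc a
  ... | a , suc b = suc a , b

  -- `unpair` walks along the antidiagonals, so the induction is on a + b and then on a.
  unpair-surjective : ∀ a b → ∃[ n ] unpair n ≡ (a , b)
  unpair-surjective a b = go (a + b) a b refl
    where
    go : ∀ s a b → a + b ≡ s → ∃[ n ] unpair n ≡ (a , b)
    go zero zero zero _ = 0 , refl
    go (suc s) zero (suc b) refl with go s s zero (+-identityʳ s)
    ... | n , eq = suc n , step
      where
      step : unpair (suc n) ≡ (0 , suc s)
      step rewrite eq = refl
    go (suc s) (suc a) b eq₀ with go (suc s) a (suc b) (trans (+-suc a b) eq₀)
    ... | n , eq = suc n , step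
      where
      step : unpair (suc n) ≡ (suc a , b)
      step rewrite eq = refl

  pair : ℕ → ℕ → ℕ
  pair a b = proj₁ (unpair-surjective a b)

  -- With A = Bool this decodes a set of naturals into a sequence of sets, so that stages indexed by
  -- `𝒫 ℕ` meet every sequence.
  row : {A : Set} → (ℕ → A) → ℕ → ℕ → A
  row f k n = f (pair k n)

  row-surjective : {A : Set} (z : ℕ → ℕ → A) → ∃[ f ] (∀ k n → row f k n ≡ z k n)
  row-surjective z = (λ m → z (proj₁ (unpair m)) (proj₂ (unpair m))) ,
    λ k n → cong (λ p → z (proj₁ p) (proj₂ p)) (proj₂ (unpair-surjective k n))

  -- Zermelo's theorem and initial well-orders.

  -- The tower of a choice function: the subsets reachable from ∅ by adding the
  -- chosen point of the complement and by taking unions. It is well-ordered by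
  -- inclusion, and its steps enumerate X.
  module Zermelo (X : Set) where

    grow : 𝒫 X → 𝒫 X
    grow A with em {P = ∃[ x ] ¬ x ∈ A}
    ... | yes (x , _) = ⟦ (λ y → y ∈ A ⊎ y ≡ x) ⟧
    ... | no _ = A

    ⊆grow : ∀ A → A ⊆ grow A
    ⊆grow A x x∈A with em {P = ∃[ x ] ¬ x ∈ A}
    ... | yes (c , _) = ⟦⟧⁺ (λ y → y ∈ A ⊎ y ≡ c) (inj₁ x∈A)
    ... | no _ = x∈A

    grow-unique : ∀ A x y → x ∈ grow A → y ∈ grow A → ¬ x ∈ A → ¬ y ∈ A → x ≡ y
    grow-unique A x y x∈ y∈ x∉A y∉A with em {P = ∃[ x ] ¬ x ∈ A}
    ... | no _ = contradiction x∈ x∉A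
    ... | yes (c , _) with ⟦⟧⁻ (λ y → y ∈ A ⊎ y ≡ c) x∈ | ⟦⟧⁻ (λ y → y ∈ A ⊎ y ≡ c) y∈
    ...   | inj₁ x∈A | _ = contradiction x∈A x∉A
    ...   | inj₂ _ | inj₁ y∈A = contradiction y∈A y∉A
    ...   | inj₂ refl | inj₂ refl = refl

    grow-proper : ∀ A x → ¬ x ∈ A → ∃[ y ] (y ∈ grow A × ¬ y ∈ A)
    grow-proper A x x∉A with em {P = ∃[ x ] ¬ x ∈ A}
    ... | yes (c , c∉A) = c , ⟦⟧⁺ (λ y → y ∈ A ⊎ y ≡ c) (inj₂ refl) , c∉A
    ... | no full = contradiction (x , x∉A) full

    InUnion : 𝒫 (𝒫 X) → X → Set
    InUnion p x = ∃[ A ] (A ∈ p × x ∈ A)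

    data Tower : 𝒫 X → Set where
      step : ∀ {A} → Tower A → Tower (grow A)
      join : ∀ p → (∀ A → A ∈ p → Tower A) → Tower ⟦ InUnion p ⟧

    -- The extreme points of the Bourbaki-Witt argument: growing never jumps over C.
    Extreme : 𝒫 X → Set
    Extreme C = ∀ A → Tower A → A ⊆ C → A ≢ C → grow A ⊆ C

    ⊆-join : ∀ {p A} → A ∈ p → A ⊆ ⟦ InUnion p ⟧
    ⊆-join {p} A∈p x x∈A = ⟦⟧⁺ (InUnion p) (_ , A∈p , x∈A)

    ⊆-trans : {A B C : 𝒫 X} → A ⊆ B → B ⊆ C → A ⊆ C
    ⊆-trans A⊆B B⊆C x = B⊆C x ∘ A⊆B x

    extreme-comparable : ∀ {C} → Extreme C → ∀ {A} → Tower A → A ⊆ C ⊎ grow C ⊆ A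
    extreme-comparable {C} extreme (step {A} tA) with extreme-comparable extreme tA
    ... | inj₂ growC⊆A = inj₂ (⊆-trans growC⊆A (⊆grow A))
    ... | inj₁ A⊆C with em {P = A ≡ C}
    ...   | yes refl = inj₂ λ _ → id
    ...   | no A≢C = inj₁ (extreme A tA A⊆C A≢C)
    extreme-comparable {C} extreme (join p tp) with em {P = ∃[ A ] (A ∈ p × grow C ⊆ A)}
    ... | yes (A , A∈p , growC⊆A) = inj₂ (⊆-trans growC⊆A (⊆-join A∈p))
    ... | no none = inj₁ λ x x∈ → let (A , A∈p , x∈A) = ⟦⟧⁻ (InUnion p) x∈ in
      [ (λ A⊆C → A⊆C x x∈A) , (λ growC⊆A → contradiction (A , A∈p , growC⊆A) none) ]′
        (extreme-comparable extreme (tp A A∈p))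

    tower-extreme : ∀ {C} → Tower C → Extreme C
    tower-extreme (step {C} tC) A tA A⊆ A≢ with extreme-comparable (tower-extreme tC) tA
    ... | inj₂ growC⊆A = contradiction (⊆-antisym A⊆ growC⊆A) A≢
    ... | inj₁ A⊆C with em {P = A ≡ C}
    ...   | yes refl = λ _ → id
    ...   | no A≢C = ⊆-trans (tower-extreme tC A tA A⊆C A≢C) (⊆grow C)
    tower-extreme (join p tp) A tA A⊆ A≢ with em {P = ∃[ C ] (C ∈ p × A ⊆ C)}
    ... | no none = contradiction (⊆-antisym A⊆ ⊆A) A≢
      where
      ⊆A : ⟦ InUnion p ⟧ ⊆ A
      ⊆A x x∈ with ⟦⟧⁻ (InUnion p) x∈
      ... | C , C∈p , x∈C with extreme-comparable (tower-extreme (tp C C∈p)) tA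
      ...   | inj₁ A⊆C = contradiction (C , C∈p , A⊆C) none
      ...   | inj₂ growC⊆A = growC⊆A x (⊆grow C x x∈C)
    ... | yes (C , C∈p , A⊆C) with em {P = A ≡ C}
    ...   | no A≢C = ⊆-trans (tower-extreme (tp C C∈p) A tA A⊆C A≢C) (⊆-join C∈p)
    ...   | yes refl with extreme-comparable (tower-extreme (tp C C∈p)) (join p tp)
    ...     | inj₁ ⊆A = contradiction (⊆-antisym A⊆ ⊆A) A≢
    ...     | inj₂ growA⊆ = growA⊆

    comparable : ∀ {A B} → Tower A → Tower B → A ⊆ B ⊎ grow B ⊆ A
    comparable tA tB = extreme-comparable (tower-extreme tB) tA

    Avoiding : X → 𝒫 X → Set
    Avoiding y A = Tower A × ¬ y ∈ A

    -- The largest tower set avoiding y, which exists because the tower is closed under unions; y is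
    -- the point that its next step adds.
    before : X → 𝒫 X
    before y = ⟦ InUnion ⟦ Avoiding y ⟧ ⟧

    before-tower : ∀ y → Tower (before y)
    before-tower y = join _ λ A A∈ → proj₁ (⟦⟧⁻ (Avoiding y) A∈)

    before-irrefl : ∀ y → ¬ y ∈ before y
    before-irrefl y y∈ with ⟦⟧⁻ (InUnion ⟦ Avoiding y ⟧) y∈
    ... | A , A∈ , y∈A = proj₂ (⟦⟧⁻ (Avoiding y) A∈) y∈A

    ∈grow-before : ∀ y → y ∈ grow (before y)
    ∈grow-before y = dne λ y∉ →
      let (z , z∈grow , z∉) = grow-proper (before y) y (before-irrefl y) in
      z∉ (⟦⟧⁺ (InUnion ⟦ Avoiding y ⟧)
            (grow (before y) , ⟦⟧⁺ (Avoiding y) (step (before-tower y) , y∉) , z∈grow))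

    before-compare : ∀ x y → x ∈ before y ⊎ before y ⊆ before x
    before-compare x y with comparable (before-tower y) (before-tower x)
    ... | inj₁ y⊆x = inj₂ y⊆x
    ... | inj₂ grow⊆ = inj₁ (grow⊆ x (∈grow-before x))

    before-tri : ∀ x y → x ∈ before y ⊎ x ≡ y ⊎ y ∈ before x
    before-tri x y with before-compare x y | before-compare y x
    ... | inj₁ x<y | _ = inj₁ x<y
    ... | inj₂ _ | inj₁ y<x = inj₂ (inj₂ y<x)
    ... | inj₂ y⊆x | inj₂ x⊆y = inj₂ (inj₁
      (grow-unique (before x) x y (∈grow-before x)
        (subst (λ A → y ∈ grow A) (⊆-antisym y⊆x x⊆y) (∈grow-before y))
        (before-irrefl x) (subst (λ A → ¬ y ∈ A) (⊆-antisym y⊆x x⊆y) (before-irrefl y))))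

    before-trans : ∀ {x y z} → x ∈ before y → y ∈ before z → x ∈ before z
    before-trans {x} {y} {z} x<y y<z with comparable (before-tower z) (before-tower y)
    ... | inj₁ z⊆y = contradiction (z⊆y y y<z) (before-irrefl y)
    ... | inj₂ grow⊆ = grow⊆ x (⊆grow (before y) x x<y)

    -- When x enters at a step from A, all its predecessors already lie in A.
    tower-accessible : ∀ {A} → Tower A → ∀ x → x ∈ A → Acc (λ x y → x ∈ before y) x
    tower-accessible (step {A} tA) x x∈grow with em {P = x ∈ A}
    ... | yes x∈A = tower-accessible tA x x∈A
    ... | no x∉A with comparable (before-tower x) tA
    ...   | inj₁ before⊆A = acc λ {y} y<x → tower-accessible tA y (before⊆A y y<x)
    ...   | inj₂ growA⊆ = contradiction (growA⊆ x x∈grow) (before-irrefl x)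
    tower-accessible (join p tp) x x∈ with ⟦⟧⁻ (InUnion p) x∈
    ... | A , A∈p , x∈A = tower-accessible (tp A A∈p) x x∈A

    before-wf : WellFounded (λ x y → x ∈ before y)
    before-wf x = tower-accessible (step (before-tower x)) x (∈grow-before x)

  record WellOrder (X : Set) : Set where
    field
      below : X → 𝒫 X
      ≺-wf : WellFounded (λ x y → x ∈ below y)
      ≺-trans : ∀ {x y z} → x ∈ below y → y ∈ below z → x ∈ below z
      ≺-tri : ∀ x y → x ∈ below y ⊎ x ≡ y ⊎ y ∈ below x

    infix 4 _≺_ _≼_
    _≺_ _≼_ : X → X → Set
    x ≺ y = x ∈ below y
    x ≼ y = ¬ y ≺ x

    least : {P : X → Set ℓ} → ∃ P → ∃[ x ] (P x × ∀ y → P y → x ≼ y)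
    least {P = P} (x , px) = go x (≺-wf x) px
      where
      go : ∀ x → Acc _≺_ x → P x → ∃[ x ] (P x × ∀ y → P y → x ≼ y)
      go x (acc rs) px with em {P = ∃[ y ] (y ≺ x × P y)}
      ... | yes (y , y≺x , py) = go y (rs y≺x) py
      ... | no least-x = x , px , λ y py y≺x → least-x (y , y≺x , py)

    IntoBelow : X → Set
    IntoBelow y = Σ[ φ ∈ (X → X) ] ((∀ {x x′} → φ x ≡ φ x′ → x ≡ x′) × ∀ x → φ x ≺ y)

    -- The order type is an initial ordinal.
    Initial : Set
    Initial = ∀ y → ¬ IntoBelow y

  zermelo : (X : Set) → WellOrder X
  zermelo X = record { below = before ; ≺-wf = before-wf ; ≺-trans = before-trans ; ≺-tri = before-tri }
    where open Zermelo X

  -- If X injects into a proper initial segment, pull the order back along an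
  -- injection into the shortest such segment.
  initial-order : (X : Set) → Σ[ O ∈ WellOrder X ] WellOrder.Initial O
  initial-order X with em {P = ∃ (WellOrder.IntoBelow (zermelo X))}
  ... | no none = zermelo X , λ y into → none (y , into)
  ... | yes short with WellOrder.least (zermelo X) short
  ...   | β , (φ , φ-inj , φ≺β) , minimal = pullback , initial
    where
    open WellOrder (zermelo X)

    φ-wf : ∀ x → Acc _≺_ (φ x) → Acc (λ x y → φ x ≺ φ y) x
    φ-wf x (acc rs) = acc λ {y} y≺x → φ-wf y (rs y≺x)

    φ-tri : ∀ x y → φ x ≺ φ y ⊎ x ≡ y ⊎ φ y ≺ φ x
    φ-tri x y with ≺-tri (φ x) (φ y)
    ... | inj₁ x≺y = inj₁ x≺y
    ... | inj₂ (inj₁ eq) = inj₂ (inj₁ (φ-inj eq))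
    ... | inj₂ (inj₂ y≺x) = inj₂ (inj₂ y≺x)

    pullback : WellOrder X
    pullback = record
      { below = λ y x → below (φ y) (φ x)
      ; ≺-wf = λ x → φ-wf x (≺-wf (φ x))
      ; ≺-trans = ≺-trans
      ; ≺-tri = φ-tri
      }

    initial : WellOrder.Initial pullback
    -- Composing with φ would put X into the segment below `φ y`, which is shorter than the one
    -- below β.
    initial y (ψ , ψ-inj , ψ≺y) =
      minimal (φ y) ((λ x → φ (ψ x)) , (λ eq → ψ-inj (φ-inj eq)) , ψ≺y) (φ≺β y)

  -- Ideals, dispersed sequences and diagonal sets.

  Ideal : (𝒫 ℕ → Set) → 𝒫 ℕ → Set
  Ideal A x = Σ[ F ∈ List (𝒫 ℕ) ] (All A F × Fin (λ n → n ∈ x × ¬ Any (n ∈_) F))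

  Ideal-⊆ : ∀ {A x y} → x ⊆ y → Ideal A y → Ideal A x
  Ideal-⊆ x⊆y (F , F⊆A , fin) = F , F⊆A , Fin-⊆ (λ { n (p , q) → x⊆y n p , q }) fin

  -- Such sequences witness positivity and, if their terms are infinite, have diagonal sets that
  -- avoid a given small subfamily.
  Dispersed : (𝒫 ℕ → Set) → (ℕ → 𝒫 ℕ) → Set
  Dispersed A z = ∀ a → A a → Eventually (λ k → z k ⟂ a)

  Dispersed-All : ∀ {A z} → Dispersed A z → ∀ {F} → All A F → Eventually (λ k → All (z k ⟂_) F)
  Dispersed-All disp [] = 0 , λ _ _ → []
  Dispersed-All disp (a∈A ∷ F⊆A) with disp _ a∈A | Dispersed-All disp F⊆A
  ... | m , p | m′ , q = m ⊔ m′ , λ k m≤k →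
    p k (≤-trans (m≤m⊔n m m′) m≤k) ∷ q k (≤-trans (m≤n⊔m m m′) m≤k)

  -- A late z k meeting x in an infinite set is almost disjoint from every set in F, so F cannot
  -- almost cover x.
  Dispersed⇒positive : ∀ {A z x} → Dispersed A z → Inf (λ k → Inf (λ n → n ∈ z k × n ∈ x)) → ¬ Ideal A x
  Dispersed⇒positive {A} {z} {x} disp inf (F , F⊆A , fin) with Inf-Eventually inf (Dispersed-All disp F⊆A)
  ... | k , infinite , z⟂F = infinite (Fin-⊆ cases (Fin-Any (z k) F z⟂F ∪-Fin fin))
    where
    cases : ∀ n → n ∈ z k × n ∈ x → (n ∈ z k × Any (n ∈_) F) ⊎ (n ∈ x × ¬ Any (n ∈_) F)
    cases n (n∈z , n∈x) with em {P = Any (n ∈_) F}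
    ... | yes n∈F = inj₁ (n∈z , n∈F)
    ... | no n∉F = inj₂ (n∈x , n∉F)

  decreasing : (x : ℕ → 𝒫 ℕ) → (∀ k → x (suc k) ⊆ x k) → ∀ {j k} → j ≤ k → x k ⊆ x j
  decreasing x step j≤k = go (≤⇒≤′ j≤k)
    where
    go : ∀ {j k} → j ≤′ k → x k ⊆ x j
    go ≤′-refl n n∈ = n∈
    go (≤′-step {k} j≤k) n n∈ = go j≤k n (step k n n∈)

  -- Either every x k meets infinitely many members in infinite sets, and z k can
  -- be cut out of x k by pairwise distinct members, or removing finitely many
  -- members from some x k makes it almost disjoint from all of A.
  disperse : ∀ {A} → (∀ a a′ → A a → A a′ → a ≢ a′ → a ⟂ a′) →
             (x : ℕ → 𝒫 ℕ) → (∀ k → x (suc k) ⊆ x k) → (∀ k → ¬ Ideal A (x k)) →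
             ∃[ z ] ((∀ k → z k ⊆ x k) × (∀ k → Infinite (z k)) × Dispersed A z)
  disperse {A} ad x step pos
    with em {P = ∃[ k ] (∃[ F ] (All A F × (∀ a → A a → ¬ Any (a ≡_) F → x k ⟂ a)))}
  ... | yes (k₀ , F , F⊆A , x⟂) = z , z⊆x , infinite , dispersed
    where
    -- Starting at `k₀` puts every term inside x k₀, which is almost disjoint from all members
    -- outside F.
    Rest : ℕ → ℕ → Set
    Rest k n = n ∈ x (k + k₀) × ¬ Any (n ∈_) F

    z : ℕ → 𝒫 ℕ
    z k = ⟦ Rest k ⟧

    z⊆x : ∀ k → z k ⊆ x k
    z⊆x k n n∈z = decreasing x step (m≤m+n k k₀) n (proj₁ (⟦⟧⁻ (Rest k) n∈z))

    infinite : ∀ k → Infinite (z k)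
    infinite k fin = pos (k + k₀) (F , F⊆A , Fin-⊆ (λ n → ⟦⟧⁺ (Rest k)) fin)

    dispersed : Dispersed A z
    dispersed a a∈A = 0 , λ k _ → z⟂a k
      where
      z⟂a : ∀ k → z k ⟂ a
      z⟂a k with em {P = Any (a ≡_) F}
      ... | yes a∈F = 0 , λ { n _ (n∈z , n∈a) → proj₂ (⟦⟧⁻ (Rest k) n∈z) (Any.map (λ { refl → n∈a }) a∈F) }
      ... | no a∉F = ⟂-⊆ {x k₀} {a}
        (λ n n∈z → decreasing x step (m≤n+m k₀ k) n (proj₁ (⟦⟧⁻ (Rest k) n∈z))) (λ _ → id) (x⟂ a a∈A a∉F)
  ... | no none = z , (λ k n → proj₁ ∘ ∩⁻ (x k) (a k)) , infinite , dispersed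
    where
    fresh : ∀ k F → All A F → ∃[ a ] (A a × ¬ Any (a ≡_) F × Infinite (x k ∩ a))
    fresh k F F⊆A = dne λ ¬fresh → none (k , F , F⊆A , λ a a∈A a∉F → dne λ ¬fin →
      ¬fresh (a , a∈A , a∉F , λ fin → ¬fin (Fin-⊆ (λ { n (p , q) → ∩⁺ (x k) a p q }) fin)))

    -- `chosen k` lists the members used before k; avoiding them keeps the new ones distinct.
    chosen : ℕ → Σ[ F ∈ List (𝒫 ℕ) ] All A F
    new : ∀ k → ∃[ a ] (A a × ¬ Any (a ≡_) (proj₁ (chosen k)) × Infinite (x k ∩ a))
    chosen zero = [] , []
    chosen (suc k) = proj₁ (new k) ∷ proj₁ (chosen k) , proj₁ (proj₂ (new k)) ∷ proj₂ (chosen k)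
    new k = fresh k (proj₁ (chosen k)) (proj₂ (chosen k))

    a : ℕ → 𝒫 ℕ
    a k = proj₁ (new k)

    z : ℕ → 𝒫 ℕ
    z k = x k ∩ a k

    infinite : ∀ k → Infinite (z k)
    infinite k = proj₂ (proj₂ (proj₂ (new k)))

    remembered : ∀ {j k} → suc j ≤′ k → Any (a j ≡_) (proj₁ (chosen k))
    remembered ≤′-refl = here refl
    remembered (≤′-step j<k) = there (remembered j<k)

    z⟂ : ∀ k b → A b → b ≢ a k → z k ⟂ b
    z⟂ k b b∈A b≢ = ⟂-⊆ {a k} {b} (λ n → proj₂ ∘ ∩⁻ (x k) (a k)) (λ _ → id)
      (ad (a k) b (proj₁ (proj₂ (new k))) b∈A (b≢ ∘ sym))

    dispersed : Dispersed A z
    dispersed b b∈A with em {P = ∃[ k ] b ≡ a k}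
    ... | no b≢ = 0 , λ k _ → z⟂ k b b∈A λ eq → b≢ (k , eq)
    ... | yes (j , refl) = suc j , λ k j<k → z⟂ k b b∈A λ eq →
      proj₁ (proj₂ (proj₂ (new k))) (subst (λ c → Any (c ≡_) _) eq (remembered (≤⇒≤′ j<k)))

  -- q takes one point far out in each z k; for given w, only the points of finitely many early
  -- terms can lie in w.
  diagonal : {W : 𝒫 ℕ → Set} → SmallSet W → (z : ℕ → 𝒫 ℕ) → (∀ k → Infinite (z k)) →
             (∀ w → W w → Eventually (λ k → z k ⟂ w)) →
             ∃[ q ] (Infinite q × (∀ n → n ∈ q → ∃[ k ] n ∈ z k) ×
                     (∀ i → Fin (λ n → n ∈ q × ¬ (∃[ k ] (i ≤ k × n ∈ z k)))) ×
                     (∀ w → W w → q ⟂ w))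
  diagonal {W} small z infinite fin with dodge small z fin
  ... | g , dodges = q , q-infinite , (λ n → from) , q⊆*z , q⟂
    where
    -- Beyond k to make q infinite, beyond `g k` to dodge W.
    point : ∀ k → ∃[ n ] (k ⊔ g k ≤ n × n ∈ z k)
    point k = infinitely-often (infinite k) (k ⊔ g k)

    pt : ℕ → ℕ
    pt k = proj₁ (point k)

    IsPoint : ℕ → Set
    IsPoint n = ∃[ k ] n ≡ pt k

    q : 𝒫 ℕ
    q = ⟦ IsPoint ⟧

    from : ∀ {n} → n ∈ q → ∃[ k ] n ∈ z k
    from n∈q with ⟦⟧⁻ IsPoint n∈q
    ... | k , refl = k , proj₂ (proj₂ (point k))

    q-infinite : Infinite q
    q-infinite = Inf-intro λ k → pt k , ≤-trans (m≤m⊔n k (g k)) (proj₁ (proj₂ (point k))) , ⟦⟧⁺ IsPoint (k , refl)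

    first-points : ∀ i → Fin (λ n → ∃[ k ] (k < i × n ≡ pt k))
    first-points i = Fin-⋃< i λ k _ → Fin-single (pt k)

    q⊆*z : ∀ i → Fin (λ n → n ∈ q × ¬ (∃[ k ] (i ≤ k × n ∈ z k)))
    q⊆*z i = Fin-⊆ early (first-points i)
      where
      early : ∀ n → n ∈ q × ¬ (∃[ k ] (i ≤ k × n ∈ z k)) → ∃[ k ] (k < i × n ≡ pt k)
      early n (n∈q , n∉z) with ⟦⟧⁻ IsPoint n∈q
      ... | k , refl = k , ≰⇒> (λ i≤k → n∉z (k , i≤k , proj₂ (proj₂ (point k)))) , refl

    q⟂ : ∀ w → W w → q ⟂ w
    q⟂ w w∈W with dodges w w∈W
    ... | m , avoids = Fin-⊆ early (first-points m)
      where
      early : ∀ n → n ∈ q × n ∈ w → ∃[ k ] (k < m × n ≡ pt k)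
      early n (n∈q , n∈w) with ⟦⟧⁻ IsPoint n∈q
      ... | k , refl = k , ≰⇒> (λ m≤k → avoids k m≤k (pt k)
        (≤-trans (m≤n⊔m k (g k)) (proj₁ (proj₂ (point k)))) (proj₂ (proj₂ (point k))) n∈w) , refl

  -- König's argument, with 2^ω written as (2^ω)^ω: J × ℕ does not cover 2^ω.
  unkilled : {J : Set} → (∀ (φ : 𝒫 ℕ → J) → ¬ (∀ {z z′} → φ z ≡ φ z′ → z ≡ z′)) →
             (Killed : J → ℕ → 𝒫 ℕ → Set) →
             (∀ j i {f g} → Killed j i f → Killed j i g → f ≡ g) →
             ∃[ f ] (∀ j i → ¬ Killed j i f)
  unkilled {J} ¬inj Killed unique = f , λ j i killed →
    proj₂ (missed i) (j , f , killed , ext (proj₂ (row-surjective z) i))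
    where
    Hit : ℕ → 𝒫 ℕ → Set
    Hit i z = ∃[ j ] (∃[ f ] (Killed j i f × row f i ≡ z))

    same : ∀ {i z z′} (h : Hit i z) (h′ : Hit i z′) → proj₁ h ≡ proj₁ h′ → z ≡ z′
    same {i} (j , f , killed , refl) (_ , f′ , killed′ , refl) refl = cong (λ f → row f i) (unique j i killed killed′)

    -- For fixed i each j accounts for at most one hit row, so hitting all rows would inject `𝒫 ℕ`
    -- into J.
    missed : ∀ i → ∃[ z ] ¬ Hit i z
    missed i = ¬∀⇒∃¬ λ hit → ¬inj (λ z → proj₁ (hit z)) λ {z} {z′} → same (hit z) (hit z′)

    z : ℕ → 𝒫 ℕ
    z i = proj₁ (missed i)

    f = proj₁ (row-surjective z)

  -- Nodes, clashes and members.

  module Splitting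
    {K : Set} (O : WellOrder K) (e : K → 𝒫 ℕ)
    (below-small : ∀ α → SmallSet (λ β → WellOrder._≺_ O β α))
    (splitting : ωω-Splitting e)
    where

    open WellOrder O

    side : K → Bool → 𝒫 ℕ
    side α true = e α
    side α false = ∁ (e α)

    side-total : ∀ α b n → n ∈ side α b ⊎ n ∈ side α (not b)
    side-total α true n with e α n
    ... | true = inj₁ tt
    ... | false = inj₂ tt
    side-total α false n with e α n
    ... | true = inj₂ tt
    ... | false = inj₁ tt

    side-disjoint : ∀ α b n → n ∈ side α b → ¬ n ∈ side α (not b)
    side-disjoint α true n p q with e α n
    ... | true = q
    ... | false = p
    side-disjoint α false n p q with e α n
    ... | true = p
    ... | false = q

    -- A partial function from K to Bool defined on an initial segment; `val` is read only on `dom`.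
    record Node : Set₁ where
      field
        dom : K → Set
        val : K → Bool
        closed : ∀ {α β} → dom β → α ≺ β → dom α

    open Node

    Clash : Node → Node → Set
    Clash ν μ = ∃[ β ] (dom ν β × dom μ β × val ν β ≡ not (val μ β))

    Extends : Node → Node → Set
    Extends ν μ = ∀ β → dom μ β → dom ν β × val ν β ≡ val μ β

    off : Node → K → 𝒫 ℕ
    off ν β = side β (not (val ν β))

    -- At a clash the two off sides are complementary, which is why clashing nodes separate sets.
    off-total : ∀ {ν μ β} → val ν β ≡ not (val μ β) → ∀ n → n ∈ off ν β ⊎ n ∈ off μ β
    off-total {ν} {μ} {β} eq n with side-total β (val ν β) n
    ... | inj₁ p = inj₂ (subst (λ b → n ∈ side β b) eq p)
    ... | inj₂ p = inj₁ p

    Follows : 𝒫 ℕ → Node → Set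
    Follows x ν = ∀ β → dom ν β → x ⟂ off ν β

    FollowsModulo : (ℕ → 𝒫 ℕ) → 𝒫 ℕ → Node → Set
    FollowsModulo y x ν = ∀ β → dom ν β →
      ∃[ m ] Fin (λ n → n ∈ x × n ∈ off ν β × ¬ (∃[ k ] (k < m × n ∈ y k)))

    -- A member of the family under construction: node 0 is the branch followed
    -- by the set modulo its pieces, node (suc k) is the branch of the k-th piece.
    record Member : Set₁ where
      field
        set : 𝒫 ℕ
        piece : ℕ → 𝒫 ℕ
        node : ℕ → Node
        piece-⊆ : ∀ k → piece k ⊆ set
        piece-follows : ∀ k → Follows (piece k) (node (suc k))
        set-follows : FollowsModulo piece set (node 0)

    open Member

    -- The exceptional pieces almost miss z, so on z the node is followed outright.
    modulo-⟂ : ∀ {y x z ν β} → FollowsModulo y x ν → dom ν β → (∀ k → y k ⟂ z) →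
               Fin (λ n → n ∈ x × n ∈ z × n ∈ off ν β)
    modulo-⟂ {y} {x} {z} {ν} {β} follows β∈ν y⟂z with follows β β∈ν
    ... | m , fin = Fin-⊆ cases (fin ∪-Fin ⟂⋃ {z} y m (λ k _ → ⟂-sym {y k} {z} (y⟂z k)))
      where
      cases : ∀ n → n ∈ x × n ∈ z × n ∈ off ν β →
              (n ∈ x × n ∈ off ν β × ¬ (∃[ k ] (k < m × n ∈ y k))) ⊎ (n ∈ z × ∃[ k ] (k < m × n ∈ y k))
      cases n (n∈x , n∈z , n∈off) with em {P = ∃[ k ] (k < m × n ∈ y k)}
      ... | yes n∈y = inj₂ (n∈z , n∈y)
      ... | no n∉y = inj₁ (n∈x , n∈off , n∉y)

    -- A clash with node 0 of M divides the intersection between two off sides. On that of ν, x is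
    -- exceptional only on pieces almost missing M; on that of M, M is exceptional only on its own
    -- pieces, which almost miss x by the clashes with their nodes.
    clash-⟂ : ∀ {y x ν} → FollowsModulo y x ν → (M : Member) → (∀ k → y k ⟂ set M) →
              (∀ i → Clash (node M i) ν) → x ⟂ set M
    clash-⟂ {y} {x} {ν} follows M y⟂M clash with clash 0
    ... | β , β∈M , β∈ν , eq =
      Fin-⊆ cases (modulo-⟂ {ν = ν} follows β∈ν y⟂M ∪-Fin
                   modulo-⟂ {z = x} {ν = node M 0} (set-follows M) β∈M piece⟂x)
      where
      piece⟂x : ∀ k → piece M k ⟂ x
      piece⟂x k with clash (suc k)
      ... | β′ , β′∈M , β′∈ν , eq′ =
        Fin-⊆ cases (piece-follows M k β′ β′∈M ∪-Fin
                     modulo-⟂ {z = piece M k} {ν = ν} follows β′∈ν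
                       (λ j → ⟂-⊆ {y j} {set M} (λ _ → id) (piece-⊆ M k) (y⟂M j)))
        where
        cases : ∀ n → n ∈ piece M k × n ∈ x →
                (n ∈ piece M k × n ∈ off (node M (suc k)) β′) ⊎ (n ∈ x × n ∈ piece M k × n ∈ off ν β′)
        cases n (n∈M , n∈x) with off-total {node M (suc k)} {ν} eq′ n
        ... | inj₁ p = inj₁ (n∈M , p)
        ... | inj₂ p = inj₂ (n∈x , n∈M , p)

      cases : ∀ n → n ∈ x × n ∈ set M →
              (n ∈ x × n ∈ set M × n ∈ off ν β) ⊎ (n ∈ set M × n ∈ x × n ∈ off (node M 0) β)
      cases n (n∈x , n∈M) with off-total {node M 0} {ν} eq n
      ... | inj₁ p = inj₂ (n∈M , n∈x , p)
      ... | inj₂ p = inj₁ (n∈x , n∈M , p)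

    Follows⇒Modulo : ∀ {x ν} → Follows x ν → FollowsModulo (λ _ _ → false) x ν
    Follows⇒Modulo follows β β∈ν = 0 , Fin-⊆ (λ { n (p , q , _) → p , q }) (follows β β∈ν)

    IsRestriction : Node → Node → K → Set
    IsRestriction ν μ λ₀ =
      (∀ β → dom ν β → β ≺ λ₀) × (∀ β → β ≺ λ₀ → dom ν β) × (∀ β → β ≺ λ₀ → val ν β ≡ val μ β)

    -- The nodes agree where both are defined and their domains are initial segments, so λ₀ can be
    -- the first index outside `dom ν`.
    restriction : ∀ ν μ → ¬ Clash ν μ → ¬ Extends ν μ → ∃[ λ₀ ] (dom μ λ₀ × IsRestriction ν μ λ₀)
    restriction ν μ ¬clash ¬extends = λ₀ , λ₀∈μ , ν⊆ , ⊆ν , agree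
      where
      missing : ∃[ β ] (dom μ β × ¬ dom ν β)
      missing with ¬∀⇒∃¬ ¬extends
      ... | β , ¬p = β , dne (λ β∉μ → ¬p λ β∈μ → contradiction β∈μ β∉μ) , λ β∈ν → ¬p λ β∈μ →
        β∈ν , dne λ v≢ → ¬clash (β , β∈ν , β∈μ , ¬-not v≢)

      first = least {P = λ β → ¬ dom ν β} (map₂ proj₂ missing)
      λ₀ = proj₁ first

      ⊆ν : ∀ β → β ≺ λ₀ → dom ν β
      ⊆ν β β≺ = dne λ β∉ν → proj₂ (proj₂ first) β β∉ν β≺

      ν⊆ : ∀ β → dom ν β → β ≺ λ₀
      ν⊆ β β∈ν with ≺-tri β λ₀
      ... | inj₁ β≺ = β≺
      ... | inj₂ (inj₁ refl) = contradiction β∈ν (proj₁ (proj₂ first))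
      ... | inj₂ (inj₂ λ≺β) = contradiction (closed ν β∈ν λ≺β) (proj₁ (proj₂ first))

      λ₀∈μ : dom μ λ₀
      λ₀∈μ with missing
      ... | β , β∈μ , β∉ν with ≺-tri λ₀ β
      ...   | inj₁ λ≺β = closed μ β∈μ λ≺β
      ...   | inj₂ (inj₁ refl) = β∈μ
      ...   | inj₂ (inj₂ β≺λ) = contradiction (⊆ν β β≺λ) β∉ν

      agree : ∀ β → β ≺ λ₀ → val ν β ≡ val μ β
      agree β β≺ = dne λ v≢ → ¬clash (β , ⊆ν β β≺ , closed μ λ₀∈μ β≺ , ¬-not v≢)

    restrictions-extend : ∀ {ν ν′ μ λ₀} → IsRestriction ν μ λ₀ → IsRestriction ν′ μ λ₀ → Extends ν ν′
    restrictions-extend (_ , ⊆ν , agree) (ν′⊆ , _ , agree′) β β∈ν′ =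
      ⊆ν β (ν′⊆ β β∈ν′) , trans (agree β (ν′⊆ β β∈ν′)) (sym (agree′ β (ν′⊆ β β∈ν′)))

    -- The splitting tree and its branches.

    -- The tree of conditions obtained by cutting every good condition along the
    -- first e α both sides of which leave it good; its infinite paths give
    -- pairwise clashing nodes.
    module Tree
      (P : Set) (Good : P → Set) (cut : P → K → Bool → P)
      (total : ∀ p α b → Good p → Good (cut p α b) ⊎ Good (cut p α (not b)))
      (split : ∀ p → Good p → ∃[ α ] ∀ b → Good (cut p α b))
      (mono : ∀ p α b β c → Good (cut (cut p α b) β c) → Good (cut p β c))
      (excl : ∀ p α b → ¬ Good (cut (cut p α b) α (not b)))
      (root : ∃ Good)
      where

      first-split : (q : ∃ Good) → ∃[ α ] ((∀ b → Good (cut (proj₁ q) α b)) ×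
                                          ∀ β → (∀ b → Good (cut (proj₁ q) β b)) → α ≼ β)
      first-split (p , good) = least (split p good)

      at : ∃ Good → K
      at q = proj₁ (first-split q)

      good-at : ∀ q b → Good (cut (proj₁ q) (at q) b)
      good-at q = proj₁ (proj₂ (first-split q))

      child : ∃ Good → Bool → ∃ Good
      child q b = cut (proj₁ q) (at q) b , good-at q b

      path : (ℕ → Bool) → ℕ → ∃ Good
      path f zero = root
      path f (suc k) = child (path f k) (f k)

      level : (ℕ → Bool) → ℕ → P
      level f k = proj₁ (path f k)

      not-both : ∀ q β → β ≺ at q → ∀ b → Good (cut (proj₁ q) β b) → ¬ Good (cut (proj₁ q) β (not b))
      not-both q β β≺ b good good′ = proj₂ (proj₂ (first-split q)) β (both b good good′) β≺
        where
        both : ∀ b → Good (cut (proj₁ q) β b) → Good (cut (proj₁ q) β (not b)) →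
               ∀ c → Good (cut (proj₁ q) β c)
        both true t f true = t
        both true t f false = f
        both false t f true = f
        both false t f false = t

      good-earlier : ∀ f {j k} → j ≤′ k → ∀ β b → Good (cut (level f k) β b) → Good (cut (level f j) β b)
      good-earlier f ≤′-refl β b good = good
      good-earlier f (≤′-step {k} j≤k) β b good =
        good-earlier f j≤k β b (mono (level f k) (at (path f k)) (f k) β b good)

      -- By `excl` the same index cannot split the child, and by `mono` an earlier one would already
      -- have split the parent.
      at-increasing : ∀ f k → at (path f k) ≺ at (path f (suc k))
      at-increasing f k with ≺-tri (at (path f k)) (at (path f (suc k)))
      ... | inj₁ lt = lt
      ... | inj₂ (inj₁ eq) = contradiction
        (subst (λ α → Good (cut (level f (suc k)) α (not (f k)))) (sym eq) (good-at (path f (suc k)) (not (f k))))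
        (excl (level f k) (at (path f k)) (f k))
      ... | inj₂ (inj₂ gt) = contradiction gt
        (proj₂ (proj₂ (first-split (path f k))) (at (path f (suc k))) λ b →
          mono (level f k) (at (path f k)) (f k) (at (path f (suc k))) b (good-at (path f (suc k)) b))

      AlwaysGood : (ℕ → Bool) → K → Set
      AlwaysGood f β = ∀ k → Good (cut (level f k) β true)

      -- The value is the side that stays good along the whole path. Only one can, since some level
      -- first splits at a later index.
      branch : (ℕ → Bool) → Node
      branch f = record
        { dom = λ β → ∃[ k ] β ≺ at (path f k)
        ; val = ⟦ AlwaysGood f ⟧
        ; closed = λ { (k , β≺) α≺β → k , ≺-trans α≺β β≺ }
        }

      -- This lets a set running through all levels follow the branch: its part off the branch ends
      -- up in a bad condition.
      not-good : ∀ f β → dom (branch f) β → ∃[ k ] ¬ Good (cut (level f k) β (not (val (branch f) β)))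
      not-good f β (k , β≺) with em {P = AlwaysGood f β}
      ... | yes always = k , not-both (path f k) β β≺ true (always k)
      ... | no ¬always = ¬∀⇒∃¬ ¬always

      -- After the k-th cut the side opposite to `f k` is bad by `excl`, so the chosen side stays
      -- good by `total`.
      val-at : ∀ f k → val (branch f) (at (path f k)) ≡ f k
      val-at f k with em {P = AlwaysGood f (at (path f k))} | f k in eq
      ... | yes _ | true = refl
      ... | no _ | false = refl
      ... | yes always | false = contradiction (always (suc k))
        (subst (λ b → ¬ Good (cut (cut (level f k) (at (path f k)) (f k)) (at (path f k)) (not b))) eq
          (excl (level f k) (at (path f k)) (f k)))
      ... | no ¬always | true = contradiction always ¬always
        where
        α = at (path f k)
        always : AlwaysGood f α
        always j with ≤-total j k
        ... | inj₁ j≤k = good-earlier f (≤⇒≤′ j≤k) α true (good-at (path f k) true)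
        ... | inj₂ k≤j with m≤n⇒m<n∨m≡n k≤j
        ...   | inj₂ refl = good-at (path f k) true
        ...   | inj₁ k<j with total (level f j) α true (proj₂ (path f j))
        ...     | inj₁ good = good
        ...     | inj₂ good = contradiction (good-earlier f (≤⇒≤′ k<j) α false good)
          (subst (λ b → ¬ Good (cut (level f (suc k)) α (not b))) eq (excl (level f k) α (f k)))

      -- By induction the paths share their splitting index, where ν prescribes the choice of both;
      -- `at-increasing` puts this index into both domains.
      extended-branch-unique : ∀ {ν} f g → Extends ν (branch f) → Extends ν (branch g) → f ≡ g
      extended-branch-unique {ν} f g νf νg = ext agree
        where
        value : ∀ f → Extends ν (branch f) → ∀ k → val ν (at (path f k)) ≡ f k
        value f νf k = trans (proj₂ (νf (at (path f k)) (suc k , at-increasing f k))) (val-at f k)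

        path-≡ : ∀ k → path f k ≡ path g k
        agree : ∀ k → f k ≡ g k
        path-≡ zero = refl
        path-≡ (suc k) = cong₂ child (path-≡ k) (agree k)
        agree k = trans (sym (value f νf k)) (trans (cong (λ q → val ν (at q)) (path-≡ k)) (value g νg k))

    infinite-sides : ∀ (c : ℕ → 𝒫 ℕ) → (∀ k → Infinite (c k)) →
                     ∃[ α ] (∀ b → Inf (λ k → Infinite (c k ∩ side α b)))
    infinite-sides c infinite with splitting c infinite
    ... | α , inside , outside = α , λ { true → inside ; false → outside }

    -- A single stage of the construction.

    module Stage
      {J : Set} (¬inj : ∀ (φ : 𝒫 ℕ → J) → ¬ (∀ {z z′} → φ z ≡ φ z′ → z ≡ z′))
      (prior : J → Member)
      (prior-⟂ : ∀ j j′ → j ≢ j′ → set (prior j) ⟂ set (prior j′))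
      (distinct : ∀ j j′ i i′ → Extends (node (prior j) i) (node (prior j′) i′) →
                  Extends (node (prior j′) i′) (node (prior j) i) → j ≡ j′)
      where

      A : 𝒫 ℕ → Set
      A a = ∃[ j ] a ≡ set (prior j)

      A-disjoint : ∀ a a′ → A a → A a′ → a ≢ a′ → a ⟂ a′
      A-disjoint a a′ (j , refl) (j′ , refl) a≢a′ = prior-⟂ j j′ λ { refl → a≢a′ refl }

      New : Node → Set
      New μ = ∀ j i → ¬ Extends (node (prior j) i) μ

      Compatible : Node → J → Set
      Compatible μ j = ∃[ i ] ¬ Clash (node (prior j) i) μ

      incompatible-⟂ : ∀ {y x μ} → FollowsModulo y x μ → ∀ j → (∀ k → y k ⟂ set (prior j)) →
                       ¬ Compatible μ j → x ⟂ set (prior j)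
      incompatible-⟂ {y} {x} {μ} follows j y⟂ incompatible =
        clash-⟂ {y} {x} {μ} follows (prior j) y⟂ λ i → dne λ ¬clash → incompatible (i , ¬clash)

      module Avoidance (μ : Node) (pt : ℕ → K) (exhausted : ∀ β → dom μ β → ∃[ k ] β ≺ pt k)
                       (μ-new : New μ) where

        dom-small : SmallSet (dom μ)
        dom-small = Small-⊆ exhausted (Small-⋃ℕ λ k → below-small (pt k))

        -- As μ is new, a compatible node is μ restricted below some λ₀ in its domain; `distinct`
        -- leaves at most one stage for each λ₀.
        compatible-small : SmallSet (Compatible μ)
        compatible-small = Small-⊆ locate
          (Small-⋃ℕ λ k → Small-⋃ (below-small (pt k)) λ λ₀ _ → Small-subsingleton λ j j′ r r′ →
            distinct j j′ (proj₁ r) (proj₁ r′)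
              (restrictions-extend {node (prior j) (proj₁ r)} {node (prior j′) (proj₁ r′)} {μ} (proj₂ r) (proj₂ r′))
              (restrictions-extend {node (prior j′) (proj₁ r′)} {node (prior j) (proj₁ r)} {μ} (proj₂ r′) (proj₂ r)))
          where
          locate : ∀ j → Compatible μ j →
                   ∃[ k ] (∃[ λ₀ ] (λ₀ ≺ pt k × ∃[ i ] IsRestriction (node (prior j) i) μ λ₀))
          locate j (i , ¬clash) with restriction (node (prior j) i) μ ¬clash (μ-new j i)
          ... | λ₀ , λ₀∈μ , restricts with exhausted λ₀ λ₀∈μ
          ...   | k , λ₀≺ = k , λ₀ , λ₀≺ , i , restricts

        CompatibleSet : 𝒫 ℕ → Set
        CompatibleSet w = ∃[ j ] (Compatible μ j × w ≡ set (prior j))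

        compatible-sets-small : SmallSet CompatibleSet
        compatible-sets-small =
          Small-⋃ compatible-small λ j _ → Small-subsingleton λ { _ _ refl refl → refl }

      module Thinning
        (μ : Node) (pt : ℕ → K) (exhausted : ∀ β → dom μ β → ∃[ k ] β ≺ pt k) (μ-new : New μ)
        (level : ℕ → 𝒫 ℕ) (level-decreases : ∀ k → level (suc k) ⊆ level k)
        (level-positive : ∀ k → ¬ Ideal A (level k))
        (level-decides : ∀ β → dom μ β → ∃[ k ] Ideal A (level k ∩ off μ β))
        where

        open Avoidance μ pt exhausted μ-new

        abstract
          dispersion : ∃[ z ] ((∀ k → z k ⊆ level k) × (∀ k → Infinite (z k)) × Dispersed A z)
          dispersion = disperse A-disjoint level level-decreases level-positive
        z = proj₁ dispersion
        z⊆level = proj₁ (proj₂ dispersion)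
        z-infinite = proj₁ (proj₂ (proj₂ dispersion))
        z-dispersed = proj₂ (proj₂ (proj₂ dispersion))

        -- Fixed in advance for every β, so that each index contributes only finitely many sets to
        -- `W`.
        cover : ∀ β → Σ[ F ∈ List (𝒫 ℕ) ] (All A F × (dom μ β →
                  ∃[ k ] Fin (λ n → n ∈ (level k ∩ off μ β) × ¬ Any (n ∈_) F)))
        cover β with em {P = dom μ β}
        ... | no β∉μ = [] , [] , λ β∈μ → contradiction β∈μ β∉μ
        ... | yes β∈μ with level-decides β β∈μ
        ...   | k , F , F⊆A , fin = F , F⊆A , λ _ → k , fin

        -- Dodging the first kind makes q follow μ, dodging the second separates q from the
        -- compatible prior sets; clashes take care of the others.
        W : 𝒫 ℕ → Set
        W w = ∃[ β ] (dom μ β × Any (w ≡_) (proj₁ (cover β))) ⊎ CompatibleSet w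

        W⊆A : ∀ w → W w → A w
        W⊆A w (inj₁ (β , _ , w∈F)) with All.lookupAny (proj₁ (proj₂ (cover β))) w∈F
        ... | a∈A , eq = subst A (sym eq) a∈A
        W⊆A w (inj₂ (j , _ , eq)) = j , eq

        abstract
          W-small : SmallSet W
          W-small = Small-⊎ (Small-⋃ dom-small λ β _ → Small-List (proj₁ (cover β))) compatible-sets-small

        abstract
          diag : ∃[ q ] (Infinite q × (∀ n → n ∈ q → ∃[ k ] n ∈ z k) ×
                         (∀ i → Fin (λ n → n ∈ q × ¬ (∃[ k ] (i ≤ k × n ∈ z k)))) ×
                         (∀ w → W w → q ⟂ w))
          diag = diagonal W-small z z-infinite (λ w w∈W → z-dispersed w (W⊆A w w∈W))
        q = proj₁ diag
        q-infinite = proj₁ (proj₂ diag)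
        q⊆⋃z = proj₁ (proj₂ (proj₂ diag))
        q⊆*z = proj₁ (proj₂ (proj₂ (proj₂ diag)))
        q⟂W = proj₂ (proj₂ (proj₂ (proj₂ diag)))

        q⊆level₀ : q ⊆ level 0
        q⊆level₀ n n∈q with q⊆⋃z n n∈q
        ... | k , n∈z = decreasing level level-decreases z≤n n (z⊆level k n n∈z)

        -- Almost all of q lies in a level whose part off μ is almost covered by F, and q almost
        -- misses the sets in F.
        follows : Follows q μ
        follows β β∈μ with proj₂ (proj₂ (cover β)) β∈μ
        ... | k , fin = Fin-⊆ cases
          (q⊆*z k ∪-Fin (fin ∪-Fin Fin-Any q F (members F λ w w∈F → q⟂W w (inj₁ (β , β∈μ , w∈F)))))
          where
          F = proj₁ (cover β)

          members : ∀ G → (∀ w → Any (w ≡_) G → q ⟂ w) → All (q ⟂_) G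
          members [] _ = []
          members (w ∷ G) q⟂ = q⟂ w (here refl) ∷ members G λ w′ → q⟂ w′ ∘ there

          cases : ∀ n → n ∈ q × n ∈ off μ β →
                  (n ∈ q × ¬ (∃[ i ] (k ≤ i × n ∈ z i))) ⊎
                  ((n ∈ (level k ∩ off μ β) × ¬ Any (n ∈_) F) ⊎ (n ∈ q × Any (n ∈_) F))
          cases n (n∈q , n∈off) with em {P = ∃[ i ] (k ≤ i × n ∈ z i)} | em {P = Any (n ∈_) F}
          ... | no n∉z | _ = inj₁ (n∈q , n∉z)
          ... | yes _ | yes n∈F = inj₂ (inj₂ (n∈q , n∈F))
          ... | yes (i , k≤i , n∈z) | no n∉F = inj₂ (inj₁
            (∩⁺ (level k) (off μ β) (decreasing level level-decreases k≤i n (z⊆level i n n∈z)) n∈off , n∉F))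

        q⟂prior : ∀ j → q ⟂ set (prior j)
        q⟂prior j with em {P = Compatible μ j}
        ... | yes compatible = q⟂W (set (prior j)) (inj₂ (j , compatible , refl))
        ... | no incompatible = incompatible-⟂ {x = q} {μ = μ} (Follows⇒Modulo {q} {μ} follows) j
          (λ _ → 0 , λ { _ _ (() , _) }) incompatible

        thinned : ∃[ q ] (q ⊆ level 0 × Infinite q × (∀ j → q ⟂ set (prior j)) × Follows q μ)
        thinned = q , q⊆level₀ , q-infinite , q⟂prior , follows

      module PositiveTree (b : 𝒫 ℕ) (b-positive : ¬ Ideal A b) where

        cut : 𝒫 ℕ → K → Bool → 𝒫 ℕ
        cut p α c = p ∩ side α c

        Good : 𝒫 ℕ → Set
        Good p = ¬ Ideal A p

        cut-⊆ : ∀ p α c → cut p α c ⊆ p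
        cut-⊆ p α c n n∈ = proj₁ (∩⁻ p (side α c) n∈)

        total : ∀ p α c → Good p → Good (cut p α c) ⊎ Good (cut p α (not c))
        total p α c good with em {P = Ideal A (cut p α c)} | em {P = Ideal A (cut p α (not c))}
        ... | no good₁ | _ = inj₁ good₁
        ... | yes _ | no good₂ = inj₂ good₂
        ... | yes (F , F⊆A , fin) | yes (F′ , F′⊆A , fin′) =
          contradiction (F ++ F′ , All.++⁺ F⊆A F′⊆A , Fin-⊆ cases (fin ∪-Fin fin′)) good
          where
          cases : ∀ n → n ∈ p × ¬ Any (n ∈_) (F ++ F′) →
                  (n ∈ cut p α c × ¬ Any (n ∈_) F) ⊎ (n ∈ cut p α (not c) × ¬ Any (n ∈_) F′)
          cases n (n∈p , n∉) with side-total α c n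
          ... | inj₁ n∈ = inj₁ (∩⁺ p (side α c) n∈p n∈ , n∉ ∘ Any.++⁺ˡ)
          ... | inj₂ n∈ = inj₂ (∩⁺ p (side α (not c)) n∈p n∈ , n∉ ∘ Any.++⁺ʳ F)

        -- One α splits a dispersed sequence inside p; each side of p then meets infinitely many
        -- terms in infinite sets.
        split : ∀ p → Good p → ∃[ α ] ∀ c → Good (cut p α c)
        split p good with disperse A-disjoint (λ _ → p) (λ _ _ → id) (λ _ → good)
        ... | z , z⊆p , infinite , dispersed with infinite-sides z infinite
        ...   | α , sides = α , λ c → Dispersed⇒positive dispersed
          (Inf-⊆ (λ k → Inf-⊆ λ n n∈ → let (n∈z , n∈side) = ∩⁻ (z k) (side α c) n∈ in
            n∈z , ∩⁺ p (side α c) (z⊆p k n n∈z) n∈side) (sides c))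

        mono : ∀ p α c β d → Good (cut (cut p α c) β d) → Good (cut p β d)
        mono p α c β d good ideal = good (Ideal-⊆ (λ n n∈ →
          let (n∈cut , n∈side) = ∩⁻ (cut p α c) (side β d) n∈ in
          ∩⁺ p (side β d) (cut-⊆ p α c n n∈cut) n∈side) ideal)

        excl : ∀ p α c → ¬ Good (cut (cut p α c) α (not c))
        excl p α c good = good ([] , [] , 0 , λ n _ (n∈ , _) →
          let (n∈cut , n∈side) = ∩⁻ (cut p α c) (side α (not c)) n∈ in
          side-disjoint α c n (proj₂ (∩⁻ p (side α c) n∈cut)) n∈side)

        open Tree (𝒫 ℕ) Good cut total split mono excl (b , b-positive)

        abstract
          survivor : ∃[ f ] New (branch f)
          survivor = unkilled ¬inj (λ j i f → Extends (node (prior j) i) (branch f))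
            (λ j i {f} {g} → extended-branch-unique {node (prior j) i} f g)

        f : ℕ → Bool
        f = proj₁ survivor

        result : ∃[ q ] (∃[ μ ] (q ⊆ b × Infinite q × (∀ j → q ⟂ set (prior j)) × Follows q μ × New μ))
        result =
          let (q , q⊆b , infinite , q⟂ , follows) =
                Thinning.thinned (branch f) (λ k → at (path f k)) (λ _ → id) (proj₂ survivor)
                  (level f) (λ k → cut-⊆ (level f k) (at (path f k)) (f k)) (λ k → proj₂ (path f k))
                  (λ β β∈ → map₂ dne (not-good f β β∈))
          in q , branch f , q⊆b , infinite , q⟂ , follows , proj₂ survivor

      abstract
        thin : ∀ b → ¬ Ideal A b →
               ∃[ q ] (∃[ μ ] (q ⊆ b × Infinite q × (∀ j → q ⟂ set (prior j)) × Follows q μ × New μ))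
        thin = PositiveTree.result

      -- The spare set witnesses that ω is still positive afterwards.
      record Extension (b : ℕ → 𝒫 ℕ) : Set₁ where
        field
          member : Member
          hits : Inf (λ n → Infinite (b n ∩ set member))
          member-⟂ : ∀ j → set member ⟂ set (prior j)
          member-new : ∀ i → New (node member i)
          spare : 𝒫 ℕ
          spare-infinite : Infinite spare
          spare-⟂-member : spare ⟂ set member
          spare-⟂ : ∀ j → spare ⟂ set (prior j)

      module Weaving
        (μ : Node) (pt : ℕ → K) (exhausted : ∀ β → dom μ β → ∃[ k ] β ≺ pt k) (μ-new : New μ)
        (y : ℕ → 𝒫 ℕ) (y-infinite : ∀ k → Infinite (y k)) (y⟂prior : ∀ k j → y k ⟂ set (prior j))
        (y-decides : ∀ β → dom μ β → Eventually (λ k → y k ⟂ off μ β))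
        (ν : ℕ → Node) (ν-new : ∀ k → New (ν k)) (y-follows : ∀ k → Follows (y k) (ν k))
        where

        open Avoidance μ pt exhausted μ-new

        -- Here each off side is almost disjoint from almost all y k, so the off sides themselves
        -- can be dodged.
        W : 𝒫 ℕ → Set
        W w = ∃[ β ] (dom μ β × w ≡ off μ β) ⊎ CompatibleSet w

        y⟂W : ∀ w → W w → Eventually (λ k → y k ⟂ w)
        y⟂W w (inj₁ (β , β∈μ , refl)) = y-decides β β∈μ
        y⟂W w (inj₂ (j , _ , refl)) = 0 , λ k _ → y⟂prior k j

        abstract
          W-small : SmallSet W
          W-small = Small-⊎ (Small-⋃ dom-small λ β _ → Small-subsingleton λ { _ _ refl refl → refl })
                            compatible-sets-small

          trim : Σ[ g ∈ (ℕ → ℕ) ] (∀ w → W w → Eventually (λ k → ∀ n → g k ≤ n → n ∈ y k → ¬ n ∈ w))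
          trim = dodge W-small y y⟂W

          sides : ∃[ α ] (∀ b → Inf (λ k → Infinite (y k ∩ side α b)))
          sides = infinite-sides y y-infinite

        g : ℕ → ℕ
        g = proj₁ trim

        α : K
        α = proj₁ sides

        InWhole : ℕ → Set
        InWhole n = ∃[ k ] (g k ≤ n × n ∈ y k)

        whole : 𝒫 ℕ
        whole = ⟦ InWhole ⟧

        -- By `trim`, all but finitely many of the tails forming `whole` miss w.
        whole∩W : ∀ w → W w → ∃[ m ] (∀ n → n ∈ whole → n ∈ w → ∃[ k ] (k < m × n ∈ y k))
        whole∩W w w∈W = m , λ n n∈whole n∈w → early n (⟦⟧⁻ InWhole n∈whole) n∈w
          where
          m = proj₁ (proj₂ trim w w∈W)
          early : ∀ n → InWhole n → n ∈ w → ∃[ k ] (k < m × n ∈ y k)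
          early n (k , g≤n , n∈y) n∈w =
            k , ≰⇒> (λ m≤k → proj₂ (proj₂ trim w w∈W) k m≤k n g≤n n∈y n∈w) , n∈y

        whole-follows : FollowsModulo y whole μ
        whole-follows β β∈μ with whole∩W (off μ β) (inj₁ (β , β∈μ , refl))
        ... | m , covered = m , 0 , λ { n _ (n∈whole , n∈off , n∉y) → n∉y (covered n n∈whole n∈off) }

        whole⟂prior : ∀ j → whole ⟂ set (prior j)
        whole⟂prior j with em {P = Compatible μ j}
        ... | no incompatible = incompatible-⟂ {y} {whole} {μ} whole-follows j (λ k → y⟂prior k j) incompatible
        ... | yes compatible with whole∩W (set (prior j)) (inj₂ (j , compatible , refl))
        ...   | m , covered = Fin-⊆ (λ { n (p , q) → q , covered n p q })
          (⟂⋃ {set (prior j)} y m (λ k _ → ⟂-sym {y k} {set (prior j)} (y⟂prior k j)))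

        -- The true half becomes the new member, the false half the spare set.
        half : Bool → 𝒫 ℕ
        half b = whole ∩ side α b

        half-⊆ : ∀ b → half b ⊆ whole
        half-⊆ b n n∈ = proj₁ (∩⁻ whole (side α b) n∈)

        half-hits : ∀ b → Inf (λ k → Infinite (y k ∩ half b))
        half-hits b = Inf-⊆ large (proj₂ sides b)
          where
          large : ∀ k → Infinite (y k ∩ side α b) → Infinite (y k ∩ half b)
          large k infinite fin = infinite (Fin-⊆ cases (Fin-below (g k) ∪-Fin fin))
            where
            cases : ∀ n → n ∈ y k ∩ side α b → n < g k ⊎ n ∈ y k ∩ half b
            cases n n∈ with ∩⁻ (y k) (side α b) n∈ | <-≤-connex n (g k)
            ... | _ | inj₁ n<g = inj₁ n<g
            ... | n∈y , n∈side | inj₂ g≤n =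
              inj₂ (∩⁺ (y k) (half b) n∈y (∩⁺ whole (side α b) (⟦⟧⁺ InWhole (k , g≤n , n∈y)) n∈side))

        half⟂prior : ∀ b j → half b ⟂ set (prior j)
        half⟂prior b j = ⟂-⊆ {whole} {set (prior j)} (half-⊆ b) (λ _ → id) (whole⟂prior j)

        nodes : ℕ → Node
        nodes zero = μ
        nodes (suc k) = ν k

        half-follows : FollowsModulo (λ k → half true ∩ y k) (half true) μ
        half-follows β β∈μ with whole-follows β β∈μ
        ... | m , fin = m , Fin-⊆ (λ { n (n∈half , n∈off , n∉) →
          half-⊆ true n n∈half , n∈off , λ { (k , k<m , n∈y) → n∉ (k , k<m , ∩⁺ (half true) (y k) n∈half n∈y) } }) fin

        member : Member
        member = record
          { set = half true
          ; piece = λ k → half true ∩ y k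
          ; node = nodes
          ; piece-⊆ = λ k n n∈ → proj₁ (∩⁻ (half true) (y k) n∈)
          ; piece-follows = λ k β β∈ν → ⟂-⊆ {y k} {off (ν k) β}
              (λ n n∈ → proj₂ (∩⁻ (half true) (y k) n∈)) (λ _ → id) (y-follows k β β∈ν)
          ; set-follows = half-follows
          }

        extension : ∀ b (n : ℕ → ℕ) → (∀ k → k ≤ n k) → (∀ k → y k ⊆ b (n k)) → Extension b
        extension b n k≤n y⊆b = record
          { member = member
          -- Since k ≤ n k, arbitrarily late k give arbitrarily late terms of b.
          ; hits = Inf-intro λ m →
              let (k , m≤k , infinite) = infinitely-often (half-hits true) m in
              n k , ≤-trans m≤k (k≤n k) , λ fin → infinite (Fin-⊆ (λ i i∈ →
                let (i∈y , i∈half) = ∩⁻ (y k) (half true) i∈ in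
                ∩⁺ (b (n k)) (half true) (y⊆b k i i∈y) i∈half) fin)
          ; member-⟂ = half⟂prior true
          ; member-new = λ { zero → μ-new ; (suc k) → ν-new k }
          ; spare = half false
          ; spare-infinite = λ fin →
              let (k , _ , infinite) = infinitely-often (half-hits false) 0 in
              infinite (Fin-⊆ (λ i i∈ → proj₂ (∩⁻ (y k) (half false) i∈)) fin)
          ; spare-⟂-member = 0 , λ { i _ (i∈f , i∈t) →
              side-disjoint α true i (proj₂ (∩⁻ whole (side α true) i∈t)) (proj₂ (∩⁻ whole (side α false) i∈f)) }
          ; spare-⟂ = half⟂prior false
          }

      module SequenceTree (x : ℕ → 𝒫 ℕ) (x-infinite : ∀ n → Infinite (x n)) where

        cut : (ℕ → 𝒫 ℕ) → K → Bool → ℕ → 𝒫 ℕ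
        cut c α b n = c n ∩ side α b

        Good : (ℕ → 𝒫 ℕ) → Set
        Good c = Inf (λ n → Infinite (c n))

        cut-⊆ : ∀ c α b n → cut c α b n ⊆ c n
        cut-⊆ c α b n i i∈ = proj₁ (∩⁻ (c n) (side α b) i∈)

        total : ∀ c α b → Good c → Good (cut c α b) ⊎ Good (cut c α (not b))
        total c α b good = Inf-⊎ (Inf-⊆ (λ n infinite → Inf-⊎ (Inf-⊆ (cases n) infinite)) good)
          where
          cases : ∀ n i → i ∈ c n → i ∈ cut c α b n ⊎ i ∈ cut c α (not b) n
          cases n i i∈c with side-total α b i
          ... | inj₁ i∈ = inj₁ (∩⁺ (c n) (side α b) i∈c i∈)
          ... | inj₂ i∈ = inj₂ (∩⁺ (c n) (side α (not b)) i∈c i∈)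

        -- The family splits a sequence of infinite terms of c; as `index k` is at least k, both
        -- sides are infinite arbitrarily late in c.
        split : ∀ c → Good c → ∃[ α ] ∀ b → Good (cut c α b)
        split c good with infinite-sides (λ k → c (index k)) (λ k → proj₂ (proj₂ (infinitely-often good k)))
          where
          index : ℕ → ℕ
          index k = proj₁ (infinitely-often good k)
        ... | α , sides = α , λ b → Inf-intro λ m →
          let (k , m≤k , infinite) = infinitely-often (sides b) m in
          _ , ≤-trans m≤k (proj₁ (proj₂ (infinitely-often good k))) , infinite

        mono : ∀ c α b β d → Good (cut (cut c α b) β d) → Good (cut c β d)
        mono c α b β d = Inf-⊆ λ n → Inf-⊆ λ i i∈ →
          let (i∈cut , i∈side) = ∩⁻ (cut c α b n) (side β d) i∈ in
          ∩⁺ (c n) (side β d) (cut-⊆ c α b n i i∈cut) i∈side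

        excl : ∀ c α b → ¬ Good (cut (cut c α b) α (not b))
        excl c α b good =
          let (n , _ , infinite) = infinitely-often good 0 in
          infinite (0 , λ i _ i∈ →
            let (i∈cut , i∈side) = ∩⁻ (cut c α b n) (side α (not b)) i∈ in
            side-disjoint α b i (proj₂ (∩⁻ (c n) (side α b) i∈cut)) i∈side)

        x-good : Good x
        x-good (m , none) = none m ≤-refl (x-infinite m)

        open Tree (ℕ → 𝒫 ℕ) Good cut total split mono excl (x , x-good)

        abstract
          survivor : ∃[ f ] New (branch f)
          survivor = unkilled ¬inj (λ j i f → Extends (node (prior j) i) (branch f))
            (λ j i {f} {g} → extended-branch-unique {node (prior j) i} f g)

        f : ℕ → Bool
        f = proj₁ survivor

        level-decreasing : ∀ n {j k} → j ≤ k → level f k n ⊆ level f j n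
        level-decreasing n = decreasing (λ k → level f k n)
          (λ k → cut-⊆ (level f k) (at (path f k)) (f k) n)

        abstract
          index : ∀ k → ∃[ n ] (k ≤ n × Infinite (level f k n))
          index k = infinitely-often (proj₂ (path f k)) k

        n : ℕ → ℕ
        n k = proj₁ (index k)

        y : ℕ → 𝒫 ℕ
        y k = level f k (n k)

        y⊆x : ∀ k → y k ⊆ x (n k)
        y⊆x k = level-decreasing (n k) {0} {k} z≤n

        -- A bad off side at level k₀ has only finitely many infinite terms. The indices `n k` pass
        -- them because k ≤ n k, and later levels only shrink.
        y-decides : ∀ β → dom (branch f) β → Eventually (λ k → y k ⟂ off (branch f) β)
        y-decides β β∈ =
          let (k₀ , ¬good) = not-good f β β∈
              (m , none) = dne ¬good
          in k₀ ⊔ m , λ k m≤k → ⟂-⊆ {level f k₀ (n k)} {off (branch f) β}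
            (level-decreasing (n k) {k₀} {k} (≤-trans (m≤m⊔n k₀ m) m≤k)) (λ _ → id)
            (Fin-⊆ (λ { i (p , q) → ∩⁺ (level f k₀ (n k)) (off (branch f) β) p q })
              (dne (none (n k) (≤-trans (m≤n⊔m k₀ m) (≤-trans m≤k (proj₁ (proj₂ (index k))))))))

        extension : ∀ b → (∀ n → x n ⊆ b n) → (∀ n j → x n ⟂ set (prior j)) →
                    (ν : ℕ → Node) → (∀ n → New (ν n)) → (∀ n → Follows (x n) (ν n)) → Extension b
        extension b x⊆b x⟂ ν ν-new x-follows =
          Weaving.extension (branch f) (λ k → at (path f k)) (λ _ → id) (proj₂ survivor)
            y (λ k → proj₂ (proj₂ (index k)))
            (λ k j → ⟂-⊆ {x (n k)} {set (prior j)} (y⊆x k) (λ _ → id) (x⟂ (n k) j))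
            y-decides (λ k → ν (n k)) (λ k → ν-new (n k))
            (λ k β β∈ → ⟂-⊆ {x (n k)} {off (ν (n k)) β} (y⊆x k) (λ _ → id) (x-follows (n k) β β∈))
            b n (λ k → proj₁ (proj₂ (index k))) (λ k i → x⊆b (n k) i ∘ y⊆x k i)

      abstract
        extend : ∀ b → (∀ n → ¬ Ideal A (b n)) → Extension b
        extend b positive =
          SequenceTree.extension (λ n → proj₁ (t n)) (λ n → proj₁ (proj₂ (proj₂ (proj₂ (t n))))) b
            (λ n → proj₁ (proj₂ (proj₂ (t n))))
            (λ n → proj₁ (proj₂ (proj₂ (proj₂ (proj₂ (t n))))))
            (λ n → proj₁ (proj₂ (t n)))
            (λ n → proj₂ (proj₂ (proj₂ (proj₂ (proj₂ (proj₂ (t n)))))))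
            (λ n → proj₁ (proj₂ (proj₂ (proj₂ (proj₂ (proj₂ (t n)))))))
          where
          t : ∀ n → ∃[ q ] (∃[ μ ] (q ⊆ b n × Infinite q × (∀ j → q ⟂ set (prior j)) × Follows q μ × New μ))
          t n = thin (b n) (positive n)

    -- The recursion of length 𝔠.

    ω-order : WellOrder (𝒫 ℕ)
    ω-order = proj₁ (initial-order (𝒫 ℕ))

    open WellOrder ω-order using () renaming
      (below to below′; _≺_ to _≺′_; ≺-wf to ≺′-wf; ≺-tri to ≺′-tri; ≺-trans to ≺′-trans)

    family : ∀ {δ} → (El (below′ δ) → Member) → 𝒫 ℕ → Set
    family prior a = ∃[ j ] a ≡ set (prior j)

    -- Only `hits` depends on whether δ codes positive sets; the other fields carry the induction
    -- through every stage.
    record IsStep (δ : 𝒫 ℕ) (prior : El (below′ δ) → Member) (M : Member) : Set where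
      field
        hits : (∀ n → ¬ Ideal (family prior) (row δ n)) → Inf (λ n → Infinite (row δ n ∩ set M))
        infinite : Infinite (set M)
        separate : ∀ j → set M ⟂ set (prior j)
        new : ∀ j i i′ → ¬ Extends (node (prior j) i) (node M i′)
        spare : ∃[ c ] (Infinite c × c ⟂ set M × ∀ j → c ⟂ set (prior j))

    open IsStep

    -- A default that makes the recursion total; `isStage` shows that every stage has a genuine
    -- step.
    junk : Member
    junk = record
      { set = λ _ → false
      ; piece = λ _ _ → false
      ; node = λ _ → record { dom = λ _ → ⊥ ; val = λ _ → false ; closed = λ { () } }
      ; piece-⊆ = λ _ _ → id
      ; piece-follows = λ _ _ ()
      ; set-follows = λ _ ()
      }

    next : ∀ δ → (El (below′ δ) → Member) → Member
    next δ prior with em {P = ∃ (IsStep δ prior)}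
    ... | yes (M , _) = M
    ... | no _ = junk

    next-step : ∀ δ prior → ∃ (IsStep δ prior) → IsStep δ prior (next δ prior)
    next-step δ prior exists with em {P = ∃ (IsStep δ prior)}
    ... | yes (_ , isStep) = isStep
    ... | no none = contradiction exists none

    abstract
      stages : Σ[ G ∈ (𝒫 ℕ → Member) ] (∀ δ → G δ ≡ next δ (λ j → G (proj₁ j)))
      stages = WF.All.wfRec ≺′-wf _ (λ _ → Member) step , λ δ →
        WF.FixPoint.unfold-wfRec ≺′-wf (λ _ → Member) step
          (λ δ eq → cong (next δ) (ext λ j → eq (proj₂ j)))
        where
        step : ∀ δ → (∀ {γ} → γ ≺′ δ → Member) → Member
        step δ prior = next δ (λ j → prior (proj₂ j))

    G : 𝒫 ℕ → Member
    G = proj₁ stages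

    IsStage : 𝒫 ℕ → Set
    IsStage δ = IsStep δ (λ j → G (proj₁ j)) (G δ)

    module Continuation (δ : 𝒫 ℕ) (earlier : ∀ γ → γ ≺′ δ → IsStage γ) where

      J : Set
      J = El (below′ δ)

      prior : J → Member
      prior j = G (proj₁ j)

      ¬inj : ∀ (φ : 𝒫 ℕ → J) → ¬ (∀ {z z′} → φ z ≡ φ z′ → z ≡ z′)
      ¬inj φ φ-inj = proj₂ (initial-order (𝒫 ℕ)) δ
        ((λ z → proj₁ (φ z)) , (λ eq → φ-inj (El-≡ {B = below′ δ} eq)) , λ z → proj₂ (φ z))

      prior-⟂ : ∀ j j′ → j ≢ j′ → set (prior j) ⟂ set (prior j′)
      prior-⟂ (γ , γ≺δ) (γ′ , γ′≺δ) j≢j′ with ≺′-tri γ γ′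
      ... | inj₁ γ≺γ′ = ⟂-sym {set (G γ′)} {set (G γ)} (separate (earlier γ′ γ′≺δ) (γ , γ≺γ′))
      ... | inj₂ (inj₁ eq) = contradiction (El-≡ {B = below′ δ} eq) j≢j′
      ... | inj₂ (inj₂ γ′≺γ) = separate (earlier γ γ≺δ) (γ′ , γ′≺γ)

      distinct : ∀ j j′ i i′ → Extends (node (prior j) i) (node (prior j′) i′) →
                 Extends (node (prior j′) i′) (node (prior j) i) → j ≡ j′
      distinct (γ , γ≺δ) (γ′ , γ′≺δ) i i′ extends extends′ with ≺′-tri γ γ′
      ... | inj₁ γ≺γ′ = contradiction extends (new (earlier γ′ γ′≺δ) (γ , γ≺γ′) i i′)
      ... | inj₂ (inj₁ eq) = El-≡ {B = below′ δ} eq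
      ... | inj₂ (inj₂ γ′≺γ) = contradiction extends′ (new (earlier γ γ≺δ) (γ′ , γ′≺γ) i′ i)

      open Stage ¬inj prior prior-⟂ distinct using (Extension; extend)
      open Extension hiding (hits; spare)

      Upto : 𝒫 ℕ → 𝒫 ℕ → Set
      Upto γ a = ∃[ γ′ ] ((γ′ ≺′ γ ⊎ γ′ ≡ γ) × a ≡ set (G γ′))

      -- The latest stage in the list matters because its spare set is almost disjoint from its own
      -- set and all earlier ones.
      last : ∀ F → All (family prior) F → F ≡ [] ⊎ ∃[ γ ] (γ ≺′ δ × All (Upto γ) F)
      last [] [] = inj₁ refl
      last (a ∷ F) (((γ₁ , γ₁≺δ) , eq) ∷ F⊆A) with last F F⊆A
      ... | inj₁ refl = inj₂ (γ₁ , γ₁≺δ , (γ₁ , inj₂ refl , eq) ∷ [])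
      ... | inj₂ (γ , γ≺δ , F-upto) with ≺′-tri γ γ₁
      ...   | inj₁ γ≺γ₁ = inj₂ (γ₁ , γ₁≺δ , (γ₁ , inj₂ refl , eq) ∷ All.map raise F-upto)
        where
        raise : ∀ {b} → Upto γ b → Upto γ₁ b
        raise (γ′ , inj₁ γ′≺γ , eq) = γ′ , inj₁ (≺′-trans γ′≺γ γ≺γ₁) , eq
        raise (γ′ , inj₂ refl , eq) = γ′ , inj₁ γ≺γ₁ , eq
      ...   | inj₂ (inj₁ refl) = inj₂ (γ , γ≺δ , (γ , inj₂ refl , eq) ∷ F-upto)
      ...   | inj₂ (inj₂ γ₁≺γ) = inj₂ (γ , γ≺δ , (γ₁ , inj₁ γ₁≺γ , eq) ∷ F-upto)

      ω : 𝒫 ℕ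
      ω _ = true

      ω-positive : ¬ Ideal (family prior) ω
      ω-positive (F , F⊆A , fin) with last F F⊆A
      ... | inj₁ refl = proj₂ fin (proj₁ fin) ≤-refl (tt , λ ())
      ... | inj₂ (γ , γ≺δ , F-upto) with spare (earlier γ γ≺δ)
      ...   | c , c-infinite , c⟂γ , c⟂earlier =
        c-infinite (Fin-⊆ cases (Fin-Any c F (All.map avoid F-upto) ∪-Fin fin))
        where
        avoid : ∀ {a} → Upto γ a → c ⟂ a
        avoid (γ′ , inj₁ γ′≺γ , refl) = c⟂earlier (γ′ , γ′≺γ)
        avoid (γ′ , inj₂ refl , refl) = c⟂γ

        cases : ∀ n → n ∈ c → (n ∈ c × Any (n ∈_) F) ⊎ (n ∈ ω × ¬ Any (n ∈_) F)
        cases n n∈c with em {P = Any (n ∈_) F}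
        ... | yes n∈F = inj₁ (n∈c , n∈F)
        ... | no n∉F = inj₂ (tt , n∉F)

      build : ∀ b → (E : Extension b) →
              ((∀ n → ¬ Ideal (family prior) (row δ n)) → b ≡ row δ) → IsStep δ prior (member E)
      build b E b≡ = record
        { hits = λ positive → subst (λ b → Inf (λ n → Infinite (b n ∩ set (member E)))) (b≡ positive) (Extension.hits E)
        ; infinite = λ fin →
            let (n , _ , infinite) = infinitely-often (Extension.hits E) 0 in
            infinite (Fin-⊆ (λ i i∈ → proj₂ (∩⁻ (b n) (set (member E)) i∈)) fin)
        ; separate = member-⟂ E
        ; new = λ j i i′ → member-new E i′ j i
        ; spare = Extension.spare E , spare-infinite E , spare-⟂-member E , spare-⟂ E
        }

      continue : ∃ (IsStep δ prior)
      continue with em {P = ∀ n → ¬ Ideal (family prior) (row δ n)}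
      ... | yes positive = _ , build (row δ) (extend (row δ) positive) (λ _ → refl)
      -- When δ does not code positive sets, the constant sequence ω still yields a new member.
      ... | no ¬positive =
        _ , build (λ _ → ω) (extend (λ _ → ω) (λ _ → ω-positive)) (λ positive → contradiction positive ¬positive)

    abstract
      isStage : ∀ δ → IsStage δ
      isStage δ = go δ (≺′-wf δ)
        where
        go : ∀ δ → Acc _≺′_ δ → IsStage δ
        go δ (acc rs) = subst (IsStep δ _) (sym (proj₂ stages δ))
          (next-step δ _ (Continuation.continue δ λ γ γ≺δ → go γ (rs γ≺δ)))

    G-⟂ : ∀ δ δ′ → δ ≢ δ′ → set (G δ) ⟂ set (G δ′)
    G-⟂ δ δ′ δ≢δ′ with ≺′-tri δ δ′
    ... | inj₁ δ≺δ′ = ⟂-sym {set (G δ′)} {set (G δ)} (separate (isStage δ′) (δ , δ≺δ′))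
    ... | inj₂ (inj₁ eq) = contradiction eq δ≢δ′
    ... | inj₂ (inj₂ δ′≺δ) = separate (isStage δ) (δ′ , δ′≺δ)

    G-injective : ∀ δ δ′ → set (G δ) ≡ set (G δ′) → δ ≡ δ′
    G-injective δ δ′ eq = dne λ δ≢δ′ →
      infinite (isStage δ) (Fin-⊆ (λ n n∈ → n∈ , subst (n ∈_) eq n∈) (G-⟂ δ δ′ δ≢δ′))

    InFamily : 𝒫 ℕ → Set
    InFamily a = ∃[ δ ] a ≡ set (G δ)

    𝒜 : 𝒫 (𝒫 ℕ)
    𝒜 = ⟦ InFamily ⟧

    weaklyTight : WeaklyTight 𝒜
    weaklyTight = record { infinite = infinite′ ; almostDisjoint = disjoint ; tight = tight }
      where
      infinite′ : ∀ a → a ∈ 𝒜 → Infinite a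
      infinite′ a a∈𝒜 with ⟦⟧⁻ InFamily a∈𝒜
      ... | δ , refl = infinite (isStage δ)

      disjoint : AlmostDisjoint 𝒜
      disjoint a a′ a∈𝒜 a′∈𝒜 a≢a′ with ⟦⟧⁻ InFamily a∈𝒜 | ⟦⟧⁻ InFamily a′∈𝒜
      ... | δ , refl | δ′ , refl =
        Fin-⊆ (λ n n∈ → ∩⁻ (set (G δ)) (set (G δ′)) {n} n∈) (G-⟂ δ δ′ λ { refl → a≢a′ refl })

      tight : (b : ℕ → 𝒫 ℕ) → (∀ n → Positive 𝒜 (b n)) → ∃[ a ] (a ∈ 𝒜 × Inf (λ n → Infinite (b n ∩ a)))
      tight b positive = set (G δ) , ⟦⟧⁺ InFamily (δ , refl) ,
        subst (λ b → Inf (λ n → Infinite (b n ∩ set (G δ)))) row≡b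
          -- The earlier sets generate a smaller ideal, so positivity passes down to stage δ.
          (hits (isStage δ) λ { n (F , F⊆A , fin) → positive n
            (F , All.map (λ { ((γ , _) , eq) → ⟦⟧⁺ InFamily (γ , eq) }) F⊆A ,
              subst (λ b → Fin (λ i → i ∈ b n × ¬ Any (i ∈_) F)) row≡b fin) })
        where
        δ = proj₁ (row-surjective b)
        row≡b : row δ ≡ b
        row≡b = ext λ k → ext λ n → proj₂ (row-surjective b) k n

    size : El 𝒜 ⤖ 𝒫 ℕ
    size = mk⤖ {to = index} (index-injective _ _ , λ δ →
      (set (G δ) , ⟦⟧⁺ InFamily (δ , refl)) , λ { refl →
        sym (G-injective δ _ (proj₂ (⟦⟧⁻ InFamily (⟦⟧⁺ InFamily (δ , refl))))) })
      where
      index : El 𝒜 → 𝒫 ℕ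
      index (a , a∈𝒜) = proj₁ (⟦⟧⁻ InFamily a∈𝒜)

      index-injective : ∀ x y → index x ≡ index y → x ≡ y
      index-injective (a , a∈𝒜) (a′ , a′∈𝒜) eq = El-≡ {B = 𝒜}
        (trans (proj₂ (⟦⟧⁻ InFamily a∈𝒜))
          (trans (cong (λ δ → set (G δ)) eq) (sym (proj₂ (⟦⟧⁻ InFamily a′∈𝒜)))))

    weaklyTightOfSize𝔠 : WeaklyTightOfSize𝔠
    weaklyTightOfSize𝔠 = 𝒜 , weaklyTight , size

  -- Comparison with 𝔟.

  𝔟≤unbounded : ∀ {B I} → Is-𝔟 B → (h : I → ℕ → ℕ) → ¬ (∃[ g ] (∀ i → h i ≤* g)) → B ↣ I
  𝔟≤unbounded {B} {I} (_ , least) h unbounded =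
    -- B injects into the range of h by minimality, and the range into I by choosing preimages.
    mk↣ {to = index} (λ {x} {y} → index-injective x y) ↣-∘ least (El F) (F , F-unbounded , ⤖-id _)
    where
    InRange : (ℕ → ℕ) → Set
    InRange f = ∃[ i ] f ≡ h i

    F : 𝒫 (ℕ → ℕ)
    F = ⟦ InRange ⟧

    F-unbounded : Unbounded F
    F-unbounded (g , bounds) = unbounded (g , λ i → bounds (h i) (⟦⟧⁺ InRange (i , refl)))

    index : El F → I
    index (f , f∈F) = proj₁ (⟦⟧⁻ InRange f∈F)

    index-injective : ∀ x y → index x ≡ index y → x ≡ y
    index-injective (f , f∈F) (f′ , f′∈F) eq = El-≡ {B = F}
      (trans (proj₂ (⟦⟧⁻ InRange f∈F)) (trans (cong h eq) (sym (proj₂ (⟦⟧⁻ InRange f′∈F)))))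

  -- This gives ω₁ ≤ 𝔟: unbounded families are uncountable.
  countable⇒bounded : {I : Set} → I ↣ ℕ → (h : I → ℕ → ℕ) → ∃[ g ] (∀ i → h i ≤* g)
  countable⇒bounded {I} I↣ℕ h = g , λ i → subst (_≤* g) (enum-code i) (proj₂ enum-bounded (code i))
    where
    open Injection I↣ℕ using () renaming (to to code; injective to code-injective)

    enum : ℕ → ℕ → ℕ
    enum n with em {P = ∃[ i ] code i ≡ n}
    ... | yes (i , _) = h i
    ... | no _ = const 0

    enum-code : ∀ i → enum (code i) ≡ h i
    enum-code i with em {P = ∃[ i′ ] code i′ ≡ code i}
    ... | yes (i′ , eq) = cong h (code-injective eq)
    ... | no none = contradiction (i , refl) none

    enum-bounded = ≤*-bounded-sequence enum
    g = proj₁ enum-bounded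

  -- The hypothesis on K says that its cardinality is at most 𝔟.
  splitting≤𝔟⇒weaklyTight : ∀ {K} (e : K → 𝒫 ℕ) → ωω-Splitting e →
    (∀ {I : Set} (h : I → ℕ → ℕ) → ¬ (∃[ g ] (∀ i → h i ≤* g)) → K ↣ I) →
    WeaklyTightOfSize𝔠
  splitting≤𝔟⇒weaklyTight {K} e splitting K≤unbounded =
    Splitting.weaklyTightOfSize𝔠 O e below-small splitting
    where
    O : WellOrder K
    O = proj₁ (initial-order K)

    open WellOrder O

    below-small : ∀ α → SmallSet (_≺ α)
    below-small α h = dne λ unbounded →
      -- An unbounded family indexed by a proper segment would inject K into that segment.
      let K↣below = K≤unbounded {El (below α)} (λ x → h (proj₁ x))
            λ { (g , bounds) → unbounded (g , λ β β≺α → bounds (β , β≺α)) }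
      in proj₂ (initial-order K) α
        ( (λ β → proj₁ (Injection.to K↣below β))
        , (λ eq → Injection.injective K↣below (El-≡ {B = below α} eq))
        , λ β → proj₂ (Injection.to K↣below β))

  -- Splitting families from dominating families.

  -- 𝔰ωω ≤ 𝔡: evens consists of every other block of an interval partition each
  -- of whose blocks [s , t) has g s < t. If g dominates the function taking s to
  -- the next element of b from s on, then b meets almost all blocks.
  module Blocks (g : ℕ → ℕ) where

    start : ℕ → ℕ
    start zero = 0
    start (suc k) = suc (start k ⊔ g (start k))

    start-< : ∀ k → start k < start (suc k)
    start-< k = s≤s (m≤m⊔n (start k) (g (start k)))

    start-mono : ∀ {j k} → j ≤ k → start j ≤ start k
    start-mono j≤k = go (≤⇒≤′ j≤k)
      where
      go : ∀ {j k} → j ≤′ k → start j ≤ start k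
      go ≤′-refl = ≤-refl
      go (≤′-step {k} j≤k) = ≤-trans (go j≤k) (<⇒≤ (start-< k))

    k≤start : ∀ k → k ≤ start k
    k≤start zero = z≤n
    k≤start (suc k) = ≤-trans (s≤s (k≤start k)) (start-< k)

    InBlock : ℕ → ℕ → Set
    InBlock k m = start k ≤ m × m < start (suc k)

    block-unique : ∀ {j k m} → InBlock j m → InBlock k m → j ≡ k
    block-unique {j} {k} (j≤ , <j) (k≤ , <k) with <-cmp j k
    ... | tri< j<k _ _ = contradiction (≤-trans (start-mono j<k) k≤) (<⇒≱ <j)
    ... | tri≈ _ eq _ = eq
    ... | tri> _ _ k<j = contradiction (≤-trans (start-mono k<j) j≤) (<⇒≱ <k)

    even : ℕ → Bool
    even zero = true
    even (suc k) = not (even k)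

    parity-beyond : ∀ c m → ∃[ k ] (m ≤ k × even k ≡ c)
    parity-beyond c m with even m in eq | c
    ... | true | true = m , ≤-refl , eq
    ... | false | false = m , ≤-refl , eq
    ... | true | false = suc m , n≤1+n m , cong not eq
    ... | false | true = suc m , n≤1+n m , cong not eq

    InEven : ℕ → Set
    InEven m = ∃[ k ] (InBlock k m × even k ≡ true)

    evens : 𝒫 ℕ
    evens = ⟦ InEven ⟧

    odd-blocks : ∀ {k m} → InBlock k m → even k ≡ false → m ∈ ∁ evens
    odd-blocks {k} {m} m∈k odd with em {P = InEven m}
    ... | no _ = tt
    ... | yes (j , m∈j , even-j) with block-unique {j} {k} m∈j m∈k
    ...   | refl = contradiction (trans (sym even-j) odd) λ ()

    module _ (b : 𝒫 ℕ) (infinite : Infinite b)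
             (dominated : (λ s → proj₁ (infinitely-often infinite s)) ≤* g) where

      point-beyond : ∀ c m → ∃[ i ] (m ≤ i × i ∈ b × ∃[ k ] (InBlock k i × even k ≡ c))
      point-beyond c m =
        let (m₀ , below-g) = dominated
            -- Past `m₀` the chosen point of b from `start k` on is at most `g (start k)`, hence
            -- inside block k.
            (k , m≤k , parity) = parity-beyond c (m ⊔ m₀)
            (i , start≤i , i∈b) = infinitely-often infinite (start k)
        in i , ≤-trans (≤-trans (m≤m⊔n m m₀) m≤k) (≤-trans (k≤start k) start≤i) , i∈b , k ,
           (start≤i , s≤s (≤-trans (below-g (start k) (≤-trans (≤-trans (m≤n⊔m m m₀) m≤k) (k≤start k)))
                                   (m≤n⊔m (start k) (g (start k))))) , parity

      meets-evens : Infinite (b ∩ evens)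
      meets-evens = Inf-intro λ m → let (i , m≤i , i∈b , k , i∈k , parity) = point-beyond true m in
        i , m≤i , ∩⁺ b evens i∈b (⟦⟧⁺ InEven (k , i∈k , parity))

      meets-odds : Infinite (b ∩ ∁ evens)
      meets-odds = Inf-intro λ m → let (i , m≤i , i∈b , k , i∈k , parity) = point-beyond false m in
        i , m≤i , ∩⁺ b (∁ evens) i∈b (odd-blocks i∈k parity)

  -- One function dominates the next-element functions of all b n; a g in F dominating it splits
  -- every b n at once.
  dominating⇒splitting : ∀ {F} → Dominating F → ωω-Splitting {El F} (λ x → Blocks.evens (proj₁ x))
  dominating⇒splitting dominating b infinite =
    let (f , dominates) = ≤*-bounded-sequence (λ n s → proj₁ (infinitely-often (infinite n) s))
        (g , g∈F , f≤*g) = dominating f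
        next≤*g = λ n → ≤*-trans (dominates n) f≤*g
    in (g , g∈F) , Inf-intro (λ n → n , ≤-refl , Blocks.meets-evens g (b n) (infinite n) (next≤*g n)) ,
                   Inf-intro (λ n → n , ≤-refl , Blocks.meets-odds g (b n) (infinite n) (next≤*g n))

theorem5 : (∀ {ℓ} → ExcludedMiddle ℓ) →
    (∀ {a b} → Extensionality a b) →
    (∀ (S B : Set) → Is-𝔰ωω S → Is-𝔟 B → (S ↣ B) → WeaklyTightOfSize𝔠)
    × (∀ (B D : Set) → Is-𝔟 B → Is-𝔡 D → (B ⤖ D) → WeaklyTightOfSize𝔠)
    × (∀ (S W : Set) → Is-𝔰ωω S → Is-ω₁ W → (S ⤖ W) → WeaklyTightOfSize𝔠)
theorem5 em ext =
    (λ { S B ((e , _ , splitting) , _) is-𝔟 S↣B →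
         splitting≤𝔟⇒weaklyTight e splitting λ h unbounded →
           𝔟≤unbounded is-𝔟 h unbounded ↣-∘ S↣B })
  -- The splitting family is indexed by a dominating family of size 𝔡 = 𝔟.
  , (λ { B D is-𝔟 ((F , dominating , F⤖D) , _) B⤖D →
         splitting≤𝔟⇒weaklyTight _ (Classical.dominating⇒splitting em ext dominating) λ h unbounded →
           𝔟≤unbounded is-𝔟 h unbounded ↣-∘ (injection (sym-≡ B⤖D) ↣-∘ injection F⤖D) })
  , (λ { S W ((e , _ , splitting) , _) (_ , ω₁≤) S⤖W →
         splitting≤𝔟⇒weaklyTight e splitting λ {I} h unbounded →
           ω₁≤ I (λ I↣ℕ → unbounded (Classical.countable⇒bounded em ext I↣ℕ h)) ↣-∘ injection S⤖W })
  where
  open Bijection using (injection)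

  splitting≤𝔟⇒weaklyTight = Classical.splitting≤𝔟⇒weaklyTight em ext
  𝔟≤unbounded = Classical.𝔟≤unbounded em ext
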